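{- Let $n$, $t$ and $s$ be positive integers with $n\geq t+s+2$. Suppose $\mathcal{F}\subseteq \binom{[n]}{t+1}$ is an $s$-almost $t$-intersecting family which is not $t$-intersecting, and that $\mathcal{F}$ has the maximum size among all $s$-almost $t$-intersecting subfamilies of $\binom{[n]}{t+1}$ that are not $t$-intersecting. Then one of the following holds. (i) $s=1$ and $\mathcal{F}\cong\left\{ F\in\binom{[t+3]}{t+1}:[t-1]\subseteq F\right\}$. (ii) $s=3$ and $\mathcal{F}\cong\left\{ F\in\binom{[t+4]}{t+1}:[t-1]\subseteq F\right\}$. (iii) $s=3$, $t\geq 2$ and $\mathcal{F}\cong\left\{ F\in \binom{[t+3]}{t+1}: [t-2]\subseteq F\right\}$. (iv) $s=6$ and $\mathcal{F}\cong\left\{F\in\binom{[t+5]}{t+1}:[t-1]\subseteq F\right\}$. (v) $s=6$, $t\geq 3$ and $\mathcal{F}\cong\left\{F\in \binom{[t+3]}{t+1}:[t-3]\subseteq F\right\}$. (vi) $s\neq 1,3$ and $\mathcal{F}\cong\left\{F\in \binom{[t+s+2]}{t+1}: [t-1]\subseteq F,\ \left|F\cap [t+1]\right|\geq t\right\}$. (vii) $s\neq 1,3$, $t\geq s$ and $\mathcal{F}\cong\left\{ F\in \binom{[t+3]}{t+1}: [t-s]\subseteq F,\ \left|F\cap [t+1]\right|\geq t\right\}$.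
   Context: $[m]=\{1,\dots,m\}$ (with $[m]=\emptyset$ for $m\leq 0$) and $\binom{X}{k}$ denotes the family of all $k$-subsets of a set $X$. A family $\mathcal{F}\subseteq\binom{[n]}{k}$ is called $s$-almost $t$-intersecting if $\left|\{F'\in\mathcal{F}: |F'\cap F|<t\}\right|\leq s$ for every $F\in\mathcal{F}$; it is $t$-intersecting if $|F\cap F'|\geq t$ for all $F,F'\in\mathcal{F}$. $\mathcal{F}\cong\mathcal{G}$ means there is a permutation of $[n]$ mapping $\mathcal{F}$ onto $\mathcal{G}$. -}

module Defs where

open import Data.Nat using (ℕ; _≤_; _<_; _<?_; _<ᵇ_; _+_; _∸_)
open import Data.Fin using (Fin; toℕ)
open import Data.Fin.Subset using (Subset; _∩_; ∣_∣; _∈_; _⊆_)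
open import Data.Fin.Permutation using (Permutation′; _⟨$⟩ˡ_)
open import Data.Vec using (tabulate; lookup)
open import Data.List using (List; length; filter)
open import Data.List.Relation.Unary.All using (All)
open import Data.List.Relation.Unary.Unique.Propositional using (Unique)
import Data.List.Membership.Propositional as LM
open import Data.Product using (_×_; ∃)
open import Relation.Nullary using (¬_)
open import Relation.Binary.PropositionalEquality using (_≡_)
open import Function.Bundles using (_⇔_)

-- A family of subsets of [n] is a duplicate-free list of subsets (Subset n = Vec Bool n);
-- its size is its length.
Family : ℕ → Set
Family n = List (Subset n)

_∈ℱ_ : {n : ℕ} → Subset n → Family n → Set
A ∈ℱ ℱ = A LM.∈ ℱ

IsUniform : {n : ℕ} → ℕ → Family n → Set
IsUniform k ℱ = Unique ℱ × All (λ A → ∣ A ∣ ≡ k) ℱ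

AlmostIntersecting : {n : ℕ} → ℕ → ℕ → Family n → Set
AlmostIntersecting s t ℱ =
  ∀ A → A ∈ℱ ℱ → length (filter (λ B → ∣ A ∩ B ∣ <? t) ℱ) ≤ s

Intersecting : {n : ℕ} → ℕ → Family n → Set
Intersecting t ℱ = ∀ A B → A ∈ℱ ℱ → B ∈ℱ ℱ → t ≤ ∣ A ∩ B ∣

-- [m] as a subset of [n] = {0,...,n-1} (elements indexed from 0: i ∈ [m] iff toℕ i < m)
initSeg : {n : ℕ} → ℕ → Subset n → Set
initSeg {n} m A = ∀ (i : Fin n) → i ∈ A → toℕ i < m

containsInit : {n : ℕ} → ℕ → Subset n → Set
containsInit {n} p A = ∀ (i : Fin n) → toℕ i < p → i ∈ A

interInitSize : {n : ℕ} → ℕ → Subset n → ℕ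
interInitSize {n} m A = ∣ A ∩ tabulate (λ i → toℕ i <ᵇ m) ∣

image : {n : ℕ} → Permutation′ n → Subset n → Subset n
image σ A = tabulate (λ j → lookup A (σ ⟨$⟩ˡ j))

IsoTo : {n : ℕ} → Family n → (Subset n → Set) → Set
IsoTo {n} ℱ P = ∃ λ (σ : Permutation′ n) → ∀ (A : Subset n) → (A ∈ℱ ℱ) ⇔ P (image σ A)

Star : {n : ℕ} → ℕ → ℕ → ℕ → Subset n → Set
Star m k p A = ∣ A ∣ ≡ k × initSeg m A × containsInit p A

Hilton : {n : ℕ} → ℕ → ℕ → ℕ → Subset n → Set
Hilton m t p A = Star m (t + 1) p A × t ≤ interInitSize (t + 1) A

{-# OPTIONS --safe #-}
-- Call two members conflicting if they meet in fewer than t elements. Let A, B ∈ ℱ conflict. Every member conflicts with A,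
-- conflicts with B, or is one of the at most four common neighbours of A and B in the Johnson graph, so |ℱ| ≤ 2s + 4; the
-- families in the conclusion show |ℱ| ≥ 2s + 3, and |ℱ| ≥ 2s + 4 for s = 1, 3. Hence |A ∖ B| = |B ∖ A| = 2, at least three of
-- the four neighbours lie in ℱ; at most one member conflicts with both A and B, and if one does then all four lie in ℱ.
-- This rigidity forces all members to contain A ∩ B or all members to be contained in A ∪ B, so ℱ is the edge set of a graph:
-- the members arise from β = A ∩ B by adding two elements, or from β = A ∪ B by removing two. In this graph any two disjoint
-- edges are joined by at least three edges. If they are always joined by four, the graph is K₄, K₅ or K₆; otherwise it is the
-- join of an edge with s + 1 isolated vertices.

module Submission where

open import Defs
open import Data.Nat using (ℕ; zero; suc; _≤_; _<_; _≥_; _+_; _∸_; _<?_; _<ᵇ_; z≤n; s≤s)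
open import Data.Nat.Properties
open import Data.Bool using (Bool; true; false; not; _∧_; _∨_; if_then_else_)
import Data.Bool.Properties as Bool
open import Data.Fin as Fin using (Fin; toℕ; fromℕ<; punchIn)
import Data.Fin.Properties as Fin
open import Data.Fin.Permutation as Perm using (Permutation′; _⟨$⟩ˡ_; _⟨$⟩ʳ_; inverseˡ; inverseʳ; insert)
open import Data.Fin.Subset using (Subset; _∩_; _∪_; ∁; ∣_∣)
import Data.Fin.Subset.Properties as Subset
open import Data.Vec using (lookup; tabulate; []; _∷_)
open import Data.Vec.Properties using (lookup∘tabulate; tabulate∘lookup; tabulate-cong; lookup-zipWith;
  lookup-map; ≡-dec; []=⇒lookup; lookup⇒[]=)
open import Data.List using (List; []; _∷_; length; filter; map; _++_; allFin; take; drop)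
open import Data.List.Properties using (length-map; length-++; length-take)
open import Data.List.Membership.Propositional using (_∈_; _∉_; find; lose)
open import Data.List.Membership.Propositional.Properties using (∈-++⁺ˡ; ∈-++⁺ʳ; ∈-++⁻; ∈-map⁺; ∈-map⁻; ∈-∃++;
  ∈-filter⁺; ∈-filter⁻; ∈-allFin)
open import Data.List.Membership.DecPropositional using () renaming (_∈?_ to mem?)
open import Data.List.Relation.Unary.Any as Any using (here; there)
open import Data.List.Relation.Unary.All as All using (All; []; _∷_)
import Data.List.Relation.Unary.All.Properties as All
open import Data.List.Relation.Unary.AllPairs as AllPairs using (AllPairs; []; _∷_)
open import Data.List.Relation.Unary.Unique.Propositional using (Unique)
import Data.List.Relation.Unary.Unique.Propositional.Properties as Unique
open import Data.Product using (_×_; _,_; proj₁; proj₂; ∃; ∃₂)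
open import Data.Sum using (_⊎_; inj₁; inj₂)
open import Data.Empty using (⊥; ⊥-elim)
open import Function using (_∘_; id; case_of_)
open import Function.Bundles using (_⇔_; mk⇔; Equivalence)
open import Function.Construct.Composition using (_⇔-∘_)
open import Relation.Nullary using (¬_; Dec; yes; no; does; contradiction; ¬?; _×-dec_)
open import Relation.Nullary.Decidable using (dec-true; dec-false; decidable-stable)
open import Relation.Unary using (Decidable)
open import Relation.Binary.PropositionalEquality using (_≡_; _≢_; refl; sym; trans; cong; cong₂; subst; module ≡-Reasoning)

-- The counting has one source. If A and B conflict, inclusion-exclusion with `∣ℱ∣ ≥ 2s + 3` shows
-- that the members conflicting with neither outnumber those conflicting with both by at least
-- three; since only four sets can conflict with neither, every rigidity statement is an instance of
-- this. The two outcomes, all members above `A ∩ B` or all below `A ∪ B`, share one graph argument.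
-- A member is recorded as the base β with two elements toggled, which adds them for `b = false` and
-- removes them for `b = true`; either way two members conflict exactly when their edges are
-- disjoint. The special values of s are edge counts: in K₄, K₅, K₆ a given edge is disjoint from 1,
-- 3, 6 others. The join of an edge with s + 1 isolated vertices has 2s + 3 edges; K₄ and K₅ beat it
-- by one (6 and 10 edges), K₆ ties with it (15 edges).

private
  variable
    n : ℕ
    X Y : Set

-- Counting in duplicate-free lists

unique⊆⇒length≤ : {xs ys : List X} → Unique xs → (∀ {x} → x ∈ xs → x ∈ ys) → length xs ≤ length ys
unique⊆⇒length≤ [] _ = z≤n
unique⊆⇒length≤ {xs = x ∷ xs} (x∉ ∷ u) sub with ∈-∃++ (sub (here refl))
... | ys , zs , refl = begin
  suc (length xs)               ≤⟨ s≤s (unique⊆⇒length≤ u sub′) ⟩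
  suc (length (ys ++ zs))       ≡⟨ cong suc (length-++ ys) ⟩
  suc (length ys + length zs)   ≡⟨ sym (+-suc (length ys) (length zs)) ⟩
  length ys + suc (length zs)   ≡⟨ sym (length-++ ys) ⟩
  length (ys ++ x ∷ zs)         ∎
  where
  open ≤-Reasoning
  sub′ : ∀ {y} → y ∈ xs → y ∈ ys ++ zs
  sub′ {y} y∈ with ∈-++⁻ ys (sub (there y∈))
  ... | inj₁ p = ∈-++⁺ˡ p
  ... | inj₂ (here refl) = contradiction refl (All.lookup x∉ y∈)
  ... | inj₂ (there p) = ∈-++⁺ʳ ys p

module _ {P Q : X → Set} (P? : Decidable P) (Q? : Decidable Q) where

  both? : Decidable (λ x → P x × Q x)
  both? x = P? x ×-dec Q? x

  neither? : Decidable (λ x → ¬ P x × ¬ Q x)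
  neither? x = ¬? (P? x) ×-dec ¬? (Q? x)

  -- Applied with P and Q the conflicts with two fixed members. The overlap stands on the left so
  -- that no subtraction occurs.
  length-inclusion-exclusion : ∀ xs → length xs + length (filter both? xs) ≡
    length (filter P? xs) + length (filter Q? xs) + length (filter neither? xs)
  length-inclusion-exclusion [] = refl
  length-inclusion-exclusion (x ∷ xs) with P? x | Q? x | length-inclusion-exclusion xs
  ... | yes _ | yes _ | ih = cong suc (trans (+-suc _ _) (trans (cong suc ih)
    (cong (_+ length (filter neither? xs)) (sym (+-suc (length (filter P? xs)) _)))))
  ... | yes _ | no _  | ih = cong suc ih
  ... | no _  | yes _ | ih = trans (cong suc ih) (cong (_+ length (filter neither? xs)) (sym (+-suc (length (filter P? xs)) _)))
  ... | no _  | no _  | ih = trans (cong suc ih) (sym (+-suc _ _))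

-- On a duplicate-free list this is the edge list of the complete graph, with one orientation per
-- edge.
pairs : List X → List (X × X)
pairs []       = []
pairs (x ∷ xs) = map (x ,_) xs ++ pairs xs

∈-pairs : {xs : List X} {x y : X} → x ∈ xs → y ∈ xs → x ≢ y → (x , y) ∈ pairs xs ⊎ (y , x) ∈ pairs xs
∈-pairs (here refl) (here refl) x≢y = contradiction refl x≢y
∈-pairs (here refl) (there q) _ = inj₁ (∈-++⁺ˡ (∈-map⁺ _ q))
∈-pairs (there p) (here refl) _ = inj₂ (∈-++⁺ˡ (∈-map⁺ _ p))
∈-pairs {xs = z ∷ zs} (there p) (there q) x≢y with ∈-pairs p q x≢y
... | inj₁ r = inj₁ (∈-++⁺ʳ (map (z ,_) zs) r)
... | inj₂ r = inj₂ (∈-++⁺ʳ (map (z ,_) zs) r)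

pairs⇒AllPairs : {R : X → X → Set} {xs : List X} {x y : X} → AllPairs R xs → (x , y) ∈ pairs xs → R x y × x ∈ xs × y ∈ xs
pairs⇒AllPairs {xs = z ∷ zs} (r ∷ rs) p with ∈-++⁻ (map (z ,_) zs) p
... | inj₁ q with ∈-map⁻ (z ,_) q
...   | w , w∈ , refl = All.lookup r w∈ , here refl , there w∈
pairs⇒AllPairs {xs = z ∷ zs} (r ∷ rs) p | inj₂ q with pairs⇒AllPairs rs q
...   | h , x∈ , y∈ = h , there x∈ , there y∈

AllPairs-lookup : {R : X → X → Set} → (∀ {x y} → R x y → R y x) → {xs : List X} → AllPairs R xs →
  ∀ {x y} → x ∈ xs → y ∈ xs → x ≢ y → R x y
AllPairs-lookup s (r ∷ rs) (here refl) (here refl) ne = contradiction refl ne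
AllPairs-lookup s (r ∷ rs) (here refl) (there q) ne = All.lookup r q
AllPairs-lookup s (r ∷ rs) (there p) (here refl) ne = s (All.lookup r p)
AllPairs-lookup s (r ∷ rs) (there p) (there q) ne = AllPairs-lookup s rs p q ne

-- Cardinalities of subsets

-- Membership in a subset is handled through its characteristic function.
infix 8 _!_
_!_ : Subset n → Fin n → Bool
S ! i = lookup S i

≢-by : (S : Subset n) {i j : Fin n} → S ! i ≡ true → S ! j ≡ false → i ≢ j
≢-by S p q refl with trans (sym p) q
... | ()

bool : ∀ x → x ≡ true ⊎ x ≡ false
bool true = inj₁ refl
bool false = inj₂ refl

subset-ext : {S S′ : Subset n} → (∀ i → S ! i ≡ S′ ! i) → S ≡ S′
subset-ext {S = S} {S′} h = trans (sym (tabulate∘lookup S)) (trans (tabulate-cong h) (tabulate∘lookup S′))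

infix 7 _∖_
_∖_ : Subset n → Subset n → Subset n
F ∖ G = F ∩ ∁ G

∩-! : (F G : Subset n) (i : Fin n) → (F ∩ G) ! i ≡ F ! i ∧ G ! i
∩-! F G i = lookup-zipWith _∧_ i F G

∪-! : (F G : Subset n) (i : Fin n) → (F ∪ G) ! i ≡ F ! i ∨ G ! i
∪-! F G i = lookup-zipWith _∨_ i F G

∖-! : (F G : Subset n) (i : Fin n) → (F ∖ G) ! i ≡ F ! i ∧ not (G ! i)
∖-! F G i = trans (∩-! F (∁ G) i) (cong (F ! i ∧_) (lookup-map i not G))

∩⁻ : (F G : Subset n) {i : Fin n} → (F ∩ G) ! i ≡ true → F ! i ≡ true × G ! i ≡ true
∩⁻ F G {i} r rewrite ∩-! F G i with F ! i | G ! i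
∩⁻ F G {i} r  | true | true = refl , refl

∖⁺ : (F G : Subset n) {i : Fin n} → F ! i ≡ true → G ! i ≡ false → (F ∖ G) ! i ≡ true
∖⁺ F G {i} p q rewrite ∖-! F G i | p | q = refl

∖⁻ : (F G : Subset n) {i : Fin n} → (F ∖ G) ! i ≡ true → F ! i ≡ true × G ! i ≡ false
∖⁻ F G {i} r rewrite ∖-! F G i with F ! i | G ! i
∖⁻ F G {i} r  | true | false = refl , refl

∣∩∣+∣∖∣ : (F G : Subset n) → ∣ F ∩ G ∣ + ∣ F ∖ G ∣ ≡ ∣ F ∣
∣∩∣+∣∖∣ [] [] = refl
∣∩∣+∣∖∣ (true ∷ F) (true ∷ G) = cong suc (∣∩∣+∣∖∣ F G)
∣∩∣+∣∖∣ (true ∷ F) (false ∷ G) = trans (+-suc _ _) (cong suc (∣∩∣+∣∖∣ F G))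
∣∩∣+∣∖∣ (false ∷ F) (true ∷ G) = ∣∩∣+∣∖∣ F G
∣∩∣+∣∖∣ (false ∷ F) (false ∷ G) = ∣∩∣+∣∖∣ F G

elems : Subset n → List (Fin n)
elems []          = []
elems (true ∷ S)  = Fin.zero ∷ map Fin.suc (elems S)
elems (false ∷ S) = map Fin.suc (elems S)

length-elems : (S : Subset n) → length (elems S) ≡ ∣ S ∣
length-elems [] = refl
length-elems (true ∷ S) = cong suc (trans (length-map Fin.suc (elems S)) (length-elems S))
length-elems (false ∷ S) = trans (length-map Fin.suc (elems S)) (length-elems S)

zero∉map-suc : (xs : List (Fin n)) → All (Fin.zero ≢_) (map Fin.suc xs)
zero∉map-suc [] = []
zero∉map-suc (x ∷ xs) = (λ ()) ∷ zero∉map-suc xs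

elems-unique : (S : Subset n) → Unique (elems S)
elems-unique [] = []
elems-unique (true ∷ S) = zero∉map-suc (elems S) ∷ Unique.map⁺ Fin.suc-injective (elems-unique S)
elems-unique (false ∷ S) = Unique.map⁺ Fin.suc-injective (elems-unique S)

∈-elems⁺ : (S : Subset n) {i : Fin n} → S ! i ≡ true → i ∈ elems S
∈-elems⁺ (true ∷ S) {Fin.zero} p = here refl
∈-elems⁺ (true ∷ S) {Fin.suc i} p = there (∈-map⁺ Fin.suc (∈-elems⁺ S p))
∈-elems⁺ (false ∷ S) {Fin.suc i} p = ∈-map⁺ Fin.suc (∈-elems⁺ S p)

∈-elems⁻ : (S : Subset n) {i : Fin n} → i ∈ elems S → S ! i ≡ true
∈-elems⁻ (true ∷ S) (here refl) = refl
∈-elems⁻ (true ∷ S) (there p) with ∈-map⁻ Fin.suc p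
... | j , q , refl = ∈-elems⁻ S q
∈-elems⁻ (false ∷ S) p with ∈-map⁻ Fin.suc p
... | j , q , refl = ∈-elems⁻ S q

length≤∣∣ : (S : Subset n) {xs : List (Fin n)} → Unique xs → (∀ {i} → i ∈ xs → S ! i ≡ true) → length xs ≤ ∣ S ∣
length≤∣∣ S u h = subst (_ ≤_) (length-elems S) (unique⊆⇒length≤ u (∈-elems⁺ S ∘ h))

∣∣≤length : (S : Subset n) {xs : List (Fin n)} → (∀ {i} → S ! i ≡ true → i ∈ xs) → ∣ S ∣ ≤ length xs
∣∣≤length S h = subst (_≤ _) (length-elems S) (unique⊆⇒length≤ (elems-unique S) (h ∘ ∈-elems⁻ S))

∣∣≡length : (S : Subset n) {xs : List (Fin n)} → Unique xs → (∀ {i} → i ∈ xs → S ! i ≡ true) →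
  (∀ {i} → S ! i ≡ true → i ∈ xs) → ∣ S ∣ ≡ length xs
∣∣≡length S u f g = ≤-antisym (∣∣≤length S g) (length≤∣∣ S u f)

unique₂ : {x y : X} → x ≢ y → Unique (x ∷ y ∷ [])
unique₂ p = (p ∷ []) ∷ [] ∷ []

two-elements⇒2≤ : (S : Subset n) {p q : Fin n} → p ≢ q → S ! p ≡ true → S ! q ≡ true → 2 ≤ ∣ S ∣
two-elements⇒2≤ S p≢q sp sq = length≤∣∣ S (unique₂ p≢q) λ { (here refl) → sp ; (there (here refl)) → sq }

2≤⇒two-elements : (S : Subset n) → 2 ≤ ∣ S ∣ → ∃₂ λ p q → p ≢ q × S ! p ≡ true × S ! q ≡ true
2≤⇒two-elements S h with elems S | length-elems S | elems-unique S | ∈-elems⁻ S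
... | p ∷ q ∷ _ | _ | (p≢q ∷ _) ∷ _ | mem = p , q , p≢q , mem (here refl) , mem (there (here refl))
... | [] | eq | _ | _ rewrite sym eq = contradiction h λ ()
... | _ ∷ [] | eq | _ | _ rewrite sym eq = contradiction h λ { (s≤s ()) }

≡2⇒two-elements : (S : Subset n) → ∣ S ∣ ≡ 2 →
  ∃₂ λ p q → p ≢ q × S ! p ≡ true × S ! q ≡ true × (∀ i → i ≢ p → i ≢ q → S ! i ≡ false)
≡2⇒two-elements S eq with 2≤⇒two-elements S (≤-reflexive (sym eq))
... | p , q , p≢q , sp , sq = p , q , p≢q , sp , sq , rest
  where
  rest : ∀ i → i ≢ p → i ≢ q → S ! i ≡ false
  rest i i≢p i≢q with bool (S ! i)
  ... | inj₂ f = f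
  ... | inj₁ si with length≤∣∣ S ((i≢p ∷ i≢q ∷ []) ∷ unique₂ p≢q)
                     (λ { (here refl) → si ; (there (here refl)) → sp ; (there (there (here refl))) → sq })
  ...   | h rewrite eq = contradiction h λ { (s≤s (s≤s ())) }

⊆⇒∩≡ : (F G : Subset n) (h : ∀ i → F ! i ≡ true → G ! i ≡ true) → F ∩ G ≡ F
⊆⇒∩≡ F G h = subset-ext λ i → trans (∩-! F G i) (lem i)
  where
  lem : ∀ i → F ! i ∧ G ! i ≡ F ! i
  lem i with F ! i | h i
  ... | true | g = g refl
  ... | false | _ = refl

∣∖∣-⊆ : (F G : Subset n) → (∀ i → G ! i ≡ true → F ! i ≡ true) → ∣ G ∣ + ∣ F ∖ G ∣ ≡ ∣ F ∣
∣∖∣-⊆ F G h = trans (cong (λ S → ∣ S ∣ + ∣ F ∖ G ∣) (sym (trans (Subset.∩-comm F G) (⊆⇒∩≡ G F h)))) (∣∩∣+∣∖∣ F G)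

not≢ : ∀ b → not b ≢ b
not≢ b = Bool.not-¬ refl ∘ sym

-- Sets obtained from a base by toggling two elements

opaque
  -- The subset β with the membership of u and of v toggled.
  T : Subset n → Fin n → Fin n → Subset n
  T β u v = tabulate λ i → if does (i Fin.≟ u) ∨ does (i Fin.≟ v) then not (β ! i) else β ! i

module _ (β : Subset n) where

  opaque
    unfolding T

    T-sym : ∀ u v → T β u v ≡ T β v u
    T-sym u v = tabulate-cong λ i → cong (if_then not (β ! i) else β ! i) (Bool.∨-comm (does (i Fin.≟ u)) _)

    T-left : ∀ u v → T β u v ! u ≡ not (β ! u)
    T-left u v rewrite lookup∘tabulate (λ i → if does (i Fin.≟ u) ∨ does (i Fin.≟ v) then not (β ! i) else β ! i) u
      | dec-true (u Fin.≟ u) refl = refl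

    T-off : ∀ {u v i} → i ≢ u → i ≢ v → T β u v ! i ≡ β ! i
    T-off {u} {v} {i} i≢u i≢v rewrite lookup∘tabulate (λ i → if does (i Fin.≟ u) ∨ does (i Fin.≟ v) then not (β ! i) else β ! i) i
      | dec-false (i Fin.≟ u) i≢u | dec-false (i Fin.≟ v) i≢v = refl

  T-right : ∀ u v → T β u v ! v ≡ not (β ! v)
  T-right u v = trans (cong (_! v) (T-sym u v)) (T-left v u)

  -- Only the set on the left toggles `u`.
  T-distinct : ∀ {u v w z} → u ≢ w → u ≢ z → T β u v ≢ T β w z
  T-distinct {u} {v} u≢w u≢z eq = not≢ (β ! u) (trans (sym (T-left u v)) (trans (cong (_! u) eq) (T-off u≢w u≢z)))

  T-ext : ∀ {N u v} → N ! u ≡ not (β ! u) → N ! v ≡ not (β ! v) → (∀ i → i ≢ u → i ≢ v → N ! i ≡ β ! i) → N ≡ T β u v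
  T-ext {N} {u} {v} hu hv h = subset-ext go
    where
    go : ∀ i → N ! i ≡ T β u v ! i
    go i with i Fin.≟ u | i Fin.≟ v
    ... | yes refl | _ = trans hu (sym (T-left u v))
    ... | no _ | yes refl = trans hv (sym (T-right u v))
    ... | no p | no q = trans (h i p q) (sym (T-off p q))

  T-row-unique : ∀ x {xs : List (Fin n)} → All (x ≢_) xs → Unique xs → Unique (map (T β x) xs)
  T-row-unique x [] [] = []
  T-row-unique x (x≢y ∷ h) (y∉ ∷ u) = All.map⁺ (All.map (λ y≢z eq → T-distinct (x≢y ∘ sym) y≢z (trans (T-sym _ x) eq)) y∉) ∷
    T-row-unique x h u

  T-pairs-unique : {xs : List (Fin n)} → Unique xs → Unique (map (λ (u , v) → T β u v) (pairs xs))
  T-pairs-unique [] = []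
  T-pairs-unique {x ∷ xs} (x∉ ∷ u) = subst Unique (sym (lem (pairs xs) xs))
    (Unique.++⁺ (T-row-unique x x∉ u) (T-pairs-unique u) disj)
    where
    lem : ∀ (qs : List (Fin n × Fin n)) (ys : List (Fin n)) →
      map (λ (u , v) → T β u v) (map (x ,_) ys ++ qs) ≡ map (T β x) ys ++ map (λ (u , v) → T β u v) qs
    lem qs [] = refl
    lem qs (y ∷ ys) = cong (T β x y ∷_) (lem qs ys)
    disj : ∀ {A} → A ∈ map (T β x) xs × A ∈ map (λ (u , v) → T β u v) (pairs xs) → ⊥
    disj (p , q) with ∈-map⁻ (T β x) p | ∈-map⁻ (λ (u , v) → T β u v) q
    ... | y , y∈ , refl | (w , z) , wz∈ , eq with pairs⇒AllPairs u wz∈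
    ...   | _ , w∈ , z∈ = T-distinct (All.lookup x∉ w∈) (All.lookup x∉ z∈) eq

-- Conflicts in an almost intersecting family

_≟ˢ_ : (A B : Subset n) → Dec (A ≡ B)
_≟ˢ_ = ≡-dec Bool._≟_

_∈ˢ?_ : (A : Subset n) (ℱ : List (Subset n)) → Dec (A ∈ ℱ)
_∈ˢ?_ = mem? _≟ˢ_

Conf : ℕ → Subset n → Subset n → Set
Conf t A B = ∣ A ∩ B ∣ < t

conf? : ∀ t (A B : Subset n) → Dec (Conf t A B)
conf? t A B = ∣ A ∩ B ∣ <? t

module _ {t : ℕ} (A B : Subset n) where

  conf-sym : Conf t A B → Conf t B A
  conf-sym = subst (_< t) (cong ∣_∣ (Subset.∩-comm A B))

  module _ (∣A∣ : ∣ A ∣ ≡ t + 1) where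

    -- The t + 1 elements of A split into `A ∩ B` and `A ∖ B`, so fewer than t common elements means
    -- at least two outside B. Conflicts are handled in this form from here on.
    conf⇒2≤∣∖∣ : Conf t A B → 2 ≤ ∣ A ∖ B ∣
    conf⇒2≤∣∖∣ c = +-cancelˡ-≤ ∣ A ∩ B ∣ 2 ∣ A ∖ B ∣ (begin
      ∣ A ∩ B ∣ + 2          ≡⟨ +-suc ∣ A ∩ B ∣ 1 ⟩
      suc ∣ A ∩ B ∣ + 1      ≤⟨ +-monoˡ-≤ 1 c ⟩
      t + 1                  ≡⟨ sym (trans (∣∩∣+∣∖∣ A B) ∣A∣) ⟩
      ∣ A ∩ B ∣ + ∣ A ∖ B ∣  ∎)
      where open ≤-Reasoning

    2≤∣∖∣⇒conf : 2 ≤ ∣ A ∖ B ∣ → Conf t A B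
    2≤∣∖∣⇒conf h = +-cancelʳ-≤ 1 _ t (begin
      suc ∣ A ∩ B ∣ + 1      ≡⟨ sym (+-suc ∣ A ∩ B ∣ 1) ⟩
      ∣ A ∩ B ∣ + 2          ≤⟨ +-monoʳ-≤ ∣ A ∩ B ∣ h ⟩
      ∣ A ∩ B ∣ + ∣ A ∖ B ∣  ≡⟨ trans (∣∩∣+∣∖∣ A B) ∣A∣ ⟩
      t + 1                  ∎)
      where open ≤-Reasoning

    two⇒conf : {p q : Fin n} → p ≢ q → A ! p ≡ true → A ! q ≡ true → B ! p ≡ false → B ! q ≡ false → Conf t A B
    two⇒conf p≢q ap aq bp bq = 2≤∣∖∣⇒conf (two-elements⇒2≤ (A ∖ B) p≢q (∖⁺ A B ap bp) (∖⁺ A B aq bq))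

    conf⇒two : Conf t A B → ∃₂ λ p q → p ≢ q × (A ! p ≡ true × B ! p ≡ false) × (A ! q ≡ true × B ! q ≡ false)
    conf⇒two c with 2≤⇒two-elements (A ∖ B) (conf⇒2≤∣∖∣ c)
    ... | p , q , p≢q , hp , hq = p , q , p≢q , ∖⁻ A B hp , ∖⁻ A B hq

-- A ∖ B = {a, b} and B ∖ A = {c, d}.
record Quad (A B : Subset n) : Set where
  field
    a b c d : Fin n
    a≢b : a ≢ b
    c≢d : c ≢ d
    Aa : A ! a ≡ true
    Ab : A ! b ≡ true
    Ac : A ! c ≡ false
    Ad : A ! d ≡ false
    Ba : B ! a ≡ false
    Bb : B ! b ≡ false
    Bc : B ! c ≡ true
    Bd : B ! d ≡ true
    rest : ∀ i → i ≢ a → i ≢ b → i ≢ c → i ≢ d → A ! i ≡ B ! i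

module AlmostIntersectingFamily {n t s : ℕ} (ℱ : Family n) (uniq : Unique ℱ) (unif : ∀ {A} → A ∈ ℱ → ∣ A ∣ ≡ t + 1)
  (almost : AlmostIntersecting s t ℱ) (large : 3 + (s + s) ≤ length ℱ) where

  -- `L` contains all members conflicting with neither A nor B, and `M` lists some that conflict
  -- with both. Each of A and B accounts for at most s conflicts; inclusion-exclusion does the rest.
  cover : ∀ {A B} → A ∈ ℱ → B ∈ ℱ → (L M : List (Subset n)) →
    (∀ {N} → N ∈ ℱ → ¬ Conf t A N → ¬ Conf t B N → N ∈ L) →
    Unique M → (∀ {N} → N ∈ M → N ∈ ℱ × Conf t A N × Conf t B N) →
    length ℱ + length M ≤ (s + s) + length L
  cover {A} {B} A∈ B∈ L M hL uM hM = begin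
    length ℱ + length M
      ≤⟨ +-monoʳ-≤ (length ℱ) (unique⊆⇒length≤ uM λ N∈ → let (p , q) = hM N∈ in ∈-filter⁺ (both? P? Q?) p q) ⟩
    length ℱ + length (filter (both? P? Q?) ℱ)
      ≡⟨ length-inclusion-exclusion P? Q? ℱ ⟩
    length (filter P? ℱ) + length (filter Q? ℱ) + length (filter (neither? P? Q?) ℱ)
      ≤⟨ +-mono-≤ (+-mono-≤ (almost A A∈) (almost B B∈)) (unique⊆⇒length≤ (Unique.filter⁺ (neither? P? Q?) uniq) λ N∈ →
           let (p , q , r) = ∈-filter⁻ (neither? P? Q?) N∈ in hL p q r) ⟩
    (s + s) + length L ∎
    where
    open ≤-Reasoning
    P? = conf? t A
    Q? = conf? t B

  -- With at least 2s + 3 members, `cover` demands at least `3 + length M` members conflicting with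
  -- neither.
  few⇒⊥ : ∀ {L M : List (Subset n)} → length L < 3 + length M → length ℱ + length M ≤ (s + s) + length L → ⊥
  few⇒⊥ {L} {M} h k = <-irrefl refl (begin-strict
    length ℱ + length M          ≤⟨ k ⟩
    (s + s) + length L           <⟨ +-monoʳ-< (s + s) h ⟩
    (s + s) + (3 + length M)     ≡⟨ sym (+-assoc (s + s) 3 (length M)) ⟩
    (s + s) + 3 + length M       ≡⟨ cong (_+ length M) (+-comm (s + s) 3) ⟩
    3 + (s + s) + length M       ≤⟨ +-monoˡ-≤ (length M) large ⟩
    length ℱ + length M          ∎)
    where open ≤-Reasoning

  -- If N contains both p and q, these are two elements of N outside B; if it contains neither, they
  -- are two elements of A outside N.
  clash : ∀ A B {N p q} → A ∈ ℱ → N ∈ ℱ → p ≢ q → A ! p ≡ true → A ! q ≡ true → B ! p ≡ false → B ! q ≡ false →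
    N ! p ≡ N ! q → ¬ Conf t A N → ¬ Conf t B N → ⊥
  clash A B {N} {p} {q} A∈ N∈ p≢q ap aq bp bq np≡nq ¬AN ¬BN with bool (N ! p)
  ... | inj₁ np = ¬BN (conf-sym N B (two⇒conf N B (unif N∈) p≢q np (trans (sym np≡nq) np) bp bq))
  ... | inj₂ np = ¬AN (two⇒conf A N (unif A∈) p≢q ap aq np (trans (sym np≡nq) np))

  -- Every set treats two of the three elements alike, so by `clash` each member conflicts with A or
  -- with B, whereas at least three members must conflict with neither.
  far₃ : ∀ A B {p q r} → A ∈ ℱ → B ∈ ℱ → p ≢ q → p ≢ r → q ≢ r →
    A ! p ≡ true → A ! q ≡ true → A ! r ≡ true → B ! p ≡ false → B ! q ≡ false → B ! r ≡ false → ⊥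
  far₃ A B {p} {q} {r} A∈ B∈ p≢q p≢r q≢r ap aq ar bp bq br =
    few⇒⊥ {[]} {[]} (s≤s z≤n) (cover {A} {B} A∈ B∈ [] [] (λ {N} N∈ x y → ⊥-elim (none N∈ x y)) [] (λ ()))
    where
    none : ∀ {N} → N ∈ ℱ → ¬ Conf t A N → ¬ Conf t B N → ⊥
    none {N} N∈ ¬AN ¬BN with N ! p in ep | N ! q in eq | N ! r in er
    ... | true | true | _ = clash A B A∈ N∈ p≢q ap aq bp bq (trans ep (sym eq)) ¬AN ¬BN
    ... | false | false | _ = clash A B A∈ N∈ p≢q ap aq bp bq (trans ep (sym eq)) ¬AN ¬BN
    ... | true | false | true = clash A B A∈ N∈ p≢r ap ar bp br (trans ep (sym er)) ¬AN ¬BN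
    ... | false | true | false = clash A B A∈ N∈ p≢r ap ar bp br (trans ep (sym er)) ¬AN ¬BN
    ... | true | false | false = clash A B A∈ N∈ q≢r aq ar bq br (trans eq (sym er)) ¬AN ¬BN
    ... | false | true | true = clash A B A∈ N∈ q≢r aq ar bq br (trans eq (sym er)) ¬AN ¬BN

  -- The conflict supplies two elements on each side and `far₃` excludes a third. The equations let
  -- the caller choose which element is `a` and which is `b`.
  quad : ∀ {A B p q} → A ∈ ℱ → B ∈ ℱ → p ≢ q → A ! p ≡ true → A ! q ≡ true → B ! p ≡ false → B ! q ≡ false →
    ∃ λ (Q : Quad A B) → Quad.a Q ≡ p × Quad.b Q ≡ q
  quad {A} {B} {p} {q} A∈ B∈ p≢q ap aq bp bq
    with conf⇒two B A (unif B∈) (conf-sym A B (two⇒conf A B (unif A∈) p≢q ap aq bp bq))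
  ... | c , d , c≢d , (bc , ac) , (bd , ad) = record
    { a = p ; b = q ; c = c ; d = d ; a≢b = p≢q ; c≢d = c≢d ; Aa = ap ; Ab = aq ; Ac = ac ; Ad = ad
    ; Ba = bp ; Bb = bq ; Bc = bc ; Bd = bd ; rest = rest } , refl , refl
    where
    rest : ∀ i → i ≢ p → i ≢ q → i ≢ c → i ≢ d → A ! i ≡ B ! i
    rest i i≢p i≢q i≢c i≢d with A ! i in ai | B ! i in bi
    ... | true | true = refl
    ... | false | false = refl
    ... | true | false = ⊥-elim (far₃ A B A∈ B∈ i≢p i≢q p≢q ai ap aq bi bp bq)
    ... | false | true = ⊥-elim (far₃ B A B∈ A∈ i≢c i≢d c≢d bi bc bd ai ac ad)

  -- Otherwise y is the only element of `G ∖ A`, so G misses p and q in addition to x, and `B ∖ G`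
  -- has three elements.
  crossing⇒conf : ∀ {A B G p q x y} → A ∈ ℱ → B ∈ ℱ → G ∈ ℱ → p ≢ q →
    B ! p ≡ true → B ! q ≡ true → A ! p ≡ false → A ! q ≡ false →
    A ! x ≡ true → B ! x ≡ true → G ! x ≡ false → A ! y ≡ false → B ! y ≡ false → G ! y ≡ true → Conf t A G
  crossing⇒conf {A} {B} {G} {y = y} A∈ B∈ G∈ p≢q bp bq ap aq ax bx gx ay by gy = decidable-stable (conf? t A G) λ ¬AG →
    let out : ∀ {i} → B ! i ≡ true → A ! i ≡ false → G ! i ≡ false
        out {i} bi ai = case bool (G ! i) of λ
          { (inj₂ gi) → gi
          ; (inj₁ gi) → contradiction (conf-sym G A (two⇒conf G A (unif G∈) (≢-by B bi by) gi gy ai ay)) ¬AG }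
    in far₃ B G B∈ G∈ p≢q (≢-by A ax ap ∘ sym) (≢-by A ax aq ∘ sym) bp bq bx (out bp ap) (out bq aq) gx

  module Neighbours {A B : Subset n} (A∈ : A ∈ ℱ) (B∈ : B ∈ ℱ) (Q : Quad A B) where
    open Quad Q

    -- For u and v outside `A ∩ B`, toggling means adding: `J a c` is `(A ∩ B) ∪ {a, c}`, one of the
    -- four common neighbours.
    J : Fin n → Fin n → Subset n
    J = T (A ∩ B)

    ∩-at : ∀ {i x} → A ! i ≡ x → B ! i ≡ x → (A ∩ B) ! i ≡ x
    ∩-at {i} {x} ai bi rewrite ∩-! A B i | ai | bi = Bool.∧-idem x

    ∩-false : ∀ {i} → A ! i ≡ false ⊎ B ! i ≡ false → (A ∩ B) ! i ≡ false
    ∩-false {i} (inj₁ e) rewrite ∩-! A B i | e = refl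
    ∩-false {i} (inj₂ e) rewrite ∩-! A B i | e = Bool.∧-zeroʳ (A ! i)

    J-left : ∀ u v → A ! u ≡ false ⊎ B ! u ≡ false → J u v ! u ≡ true
    J-left u v h = trans (T-left (A ∩ B) u v) (cong not (∩-false h))

    J-right : ∀ u v → A ! v ≡ false ⊎ B ! v ≡ false → J u v ! v ≡ true
    J-right u v h = trans (T-right (A ∩ B) u v) (cong not (∩-false h))

    J-off : ∀ {u v i x} → i ≢ u → i ≢ v → A ! i ≡ x → B ! i ≡ x → J u v ! i ≡ x
    J-off i≢u i≢v ai bi = trans (T-off (A ∩ B) i≢u i≢v) (∩-at ai bi)

    J-off-false : ∀ {u v i} → i ≢ u → i ≢ v → A ! i ≡ false ⊎ B ! i ≡ false → J u v ! i ≡ false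
    J-off-false i≢u i≢v h = trans (T-off (A ∩ B) i≢u i≢v) (∩-false h)

    -- Away from the four elements N cannot differ from A: an element lost would join p′ in `A ∖ N`,
    -- an element gained would join q in `N ∖ A`. The primes mark the partners, so one argument
    -- serves all four neighbours.
    agree : ∀ {N p p′ q q′} → N ∈ ℱ → ¬ Conf t A N → ¬ Conf t B N →
      A ! p ≡ true → A ! p′ ≡ true → B ! p ≡ false → B ! p′ ≡ false →
      A ! q ≡ false → A ! q′ ≡ false → B ! q ≡ true → B ! q′ ≡ true →
      (∀ i → i ≢ p → i ≢ p′ → i ≢ q → i ≢ q′ → A ! i ≡ B ! i) →
      N ! p ≡ true → N ! p′ ≡ false → N ! q ≡ true → N ! q′ ≡ false → N ≡ J p q
    agree {N} {p} {p′} {q} {q′} N∈ ¬AN ¬BN ap ap′ bp bp′ aq aq′ bq bq′ rst np np′ nq nq′ =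
      T-ext (A ∩ B) (trans np (sym (cong not (∩-false (inj₂ bp))))) (trans nq (sym (cong not (∩-false (inj₁ aq))))) other
      where
      other : ∀ i → i ≢ p → i ≢ q → N ! i ≡ (A ∩ B) ! i
      other i i≢p i≢q with i Fin.≟ p′ | i Fin.≟ q′
      ... | yes refl | _ = trans np′ (sym (∩-false (inj₂ bp′)))
      ... | no _ | yes refl = trans nq′ (sym (∩-false (inj₁ aq′)))
      ... | no i≢p′ | no i≢q′ with rst i i≢p i≢p′ i≢q i≢q′ | A ! i in ai | N ! i in ni
      ...   | e | true | true = sym (∩-at ai (trans (sym e) ai))
      ...   | e | false | false = sym (∩-at ai (trans (sym e) ai))
      ...   | e | true | false = ⊥-elim (¬AN (two⇒conf A N (unif A∈) i≢p′ ai ap′ ni np′))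
      ...   | e | false | true = ⊥-elim (¬AN (conf-sym N A (two⇒conf N A (unif N∈) i≢q ni nq ai aq)))

    -- By `clash`, N contains exactly one of a, b and exactly one of c, d.
    common : ∀ {N} → N ∈ ℱ → ¬ Conf t A N → ¬ Conf t B N →
      N ∈ J a c ∷ J a d ∷ J b c ∷ J b d ∷ []
    common {N} N∈ ¬AN ¬BN with N ! a in na | N ! b in nb | N ! c in nc | N ! d in nd
    ... | true | true | _ | _ = ⊥-elim (clash A B A∈ N∈ a≢b Aa Ab Ba Bb (trans na (sym nb)) ¬AN ¬BN)
    ... | false | false | _ | _ = ⊥-elim (clash A B A∈ N∈ a≢b Aa Ab Ba Bb (trans na (sym nb)) ¬AN ¬BN)
    ... | _ | _ | true | true = ⊥-elim (clash B A B∈ N∈ c≢d Bc Bd Ac Ad (trans nc (sym nd)) ¬BN ¬AN)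
    ... | _ | _ | false | false = ⊥-elim (clash B A B∈ N∈ c≢d Bc Bd Ac Ad (trans nc (sym nd)) ¬BN ¬AN)
    ... | true | false | true | false =
      here (agree N∈ ¬AN ¬BN Aa Ab Ba Bb Ac Ad Bc Bd rest na nb nc nd)
    ... | true | false | false | true =
      there (here (agree N∈ ¬AN ¬BN Aa Ab Ba Bb Ad Ac Bd Bc (λ i w x y z → rest i w x z y) na nb nd nc))
    ... | false | true | true | false =
      there (there (here (agree N∈ ¬AN ¬BN Ab Aa Bb Ba Ac Ad Bc Bd (λ i w x y z → rest i x w y z) nb na nc nd)))
    ... | false | true | false | true =
      there (there (there (here (agree N∈ ¬AN ¬BN Ab Aa Bb Ba Ad Ac Bd Bc (λ i w x y z → rest i x w z y) nb na nd nc))))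

    -- A member conflicting with both A and B raises the required number of common neighbours from
    -- three to four.
    three⇒⊥ : ∀ {G} → G ∈ ℱ → Conf t A G → Conf t B G → ∀ P Q R →
      (∀ {N} → N ∈ ℱ → N ∈ J a c ∷ J a d ∷ J b c ∷ J b d ∷ [] → N ∈ P ∷ Q ∷ R ∷ []) → ⊥
    three⇒⊥ {G} G∈ AG BG P Q R h = few⇒⊥ {P ∷ Q ∷ R ∷ []} {G ∷ []} ≤-refl (cover A∈ B∈ (P ∷ Q ∷ R ∷ []) (G ∷ [])
      (λ N∈ x y → h N∈ (common N∈ x y)) ([] ∷ []) (λ { (here refl) → G∈ , AG , BG }))

    all-four : ∀ {G} → G ∈ ℱ → Conf t A G → Conf t B G → J a c ∈ ℱ × J a d ∈ ℱ × J b c ∈ ℱ × J b d ∈ ℱ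
    all-four {G} G∈ AG BG with J a c ∈ˢ? ℱ | J a d ∈ˢ? ℱ | J b c ∈ˢ? ℱ | J b d ∈ˢ? ℱ
    ... | yes p | yes q | yes r | yes s = p , q , r , s
    ... | no h | _ | _ | _ = ⊥-elim (three⇒⊥ G∈ AG BG (J a d) (J b c) (J b d) λ
      { N∈ (here refl) → contradiction N∈ h ; _ (there m) → m })
    ... | yes _ | no h | _ | _ = ⊥-elim (three⇒⊥ G∈ AG BG (J a c) (J b c) (J b d) λ
      { N∈ (there (here refl)) → contradiction N∈ h ; _ (here e) → here e ; _ (there (there m)) → there m })
    ... | yes _ | yes _ | no h | _ = ⊥-elim (three⇒⊥ G∈ AG BG (J a c) (J a d) (J b d) λ
      { N∈ (there (there (here refl))) → contradiction N∈ h ; _ (here e) → here e ; _ (there (here e)) → there (here e)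
      ; _ (there (there (there m))) → there (there m) })
    ... | yes _ | yes _ | yes _ | no h = ⊥-elim (three⇒⊥ G∈ AG BG (J a c) (J a d) (J b c) λ
      { N∈ (there (there (there (here refl)))) → contradiction N∈ h ; _ (here e) → here e ; _ (there (here e)) → there (here e)
      ; _ (there (there (here e))) → there (there (here e)) })

    -- Two of the four common neighbours cannot both be absent, so `J a c` or `J a d` is a member.
    separating : ∃ λ N → N ∈ ℱ × N ! a ≡ true × N ! b ≡ false
    separating with J a c ∈ˢ? ℱ | J a d ∈ˢ? ℱ
    ... | yes p | _ = J a c , p , J-left a c (inj₂ Ba) , J-off-false (a≢b ∘ sym) (≢-by A Ab Ac) (inj₂ Bb)
    ... | no _ | yes p = J a d , p , J-left a d (inj₂ Ba) , J-off-false (a≢b ∘ sym) (≢-by A Ab Ad) (inj₂ Bb)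
    ... | no h | no k = ⊥-elim (few⇒⊥ {J b c ∷ J b d ∷ []} {[]} ≤-refl (cover A∈ B∈ (J b c ∷ J b d ∷ []) []
           (λ N∈ x y → case common N∈ x y of λ
             { (here refl) → contradiction N∈ h ; (there (here refl)) → contradiction N∈ k ; (there (there m)) → m })
           [] (λ ())))

    -- A member G leaving the interval [A ∩ B, A ∪ B] on both sides conflicts with A and B, so all six sets A, B, J p q
    -- lie in ℱ; but G agrees on two of a, b, c, and then differs from one of the six in three elements.
    no-crossing : ∀ {G x y} → G ∈ ℱ → A ! x ≡ true → B ! x ≡ true → G ! x ≡ false →
      A ! y ≡ false → B ! y ≡ false → G ! y ≡ true → ⊥
    no-crossing {G} {x} {y} G∈ ax bx gx ay by gy = final (all-four G∈ AG BG)
      where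
      x≢a : x ≢ a
      x≢a = ≢-by B bx Ba
      x≢b : x ≢ b
      x≢b = ≢-by B bx Bb
      x≢c : x ≢ c
      x≢c = ≢-by A ax Ac
      y≢a : y ≢ a
      y≢a = ≢-by A Aa ay ∘ sym
      y≢b : y ≢ b
      y≢b = ≢-by A Ab ay ∘ sym
      y≢c : y ≢ c
      y≢c = ≢-by B Bc by ∘ sym
      y≢d : y ≢ d
      y≢d = ≢-by B Bd by ∘ sym
      a≢c : a ≢ c
      a≢c = ≢-by A Aa Ac
      b≢c : b ≢ c
      b≢c = ≢-by A Ab Ac
      a≢d : a ≢ d
      a≢d = ≢-by A Aa Ad
      b≢d : b ≢ d
      b≢d = ≢-by A Ab Ad

      AG = crossing⇒conf A∈ B∈ G∈ c≢d Bc Bd Ac Ad ax bx gx ay by gy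
      BG = crossing⇒conf B∈ A∈ G∈ a≢b Aa Ab Ba Bb bx ax gx by ay gy

      final : J a c ∈ ℱ × J a d ∈ ℱ × J b c ∈ ℱ × J b d ∈ ℱ → ⊥
      final (ac∈ , ad∈ , bc∈ , bd∈) with G ! a in ga | G ! b in gb | G ! c in gc
      ... | false | false | _ = far₃ A G A∈ G∈ a≢b (x≢a ∘ sym) (x≢b ∘ sym) Aa Ab ax ga gb gx
      ... | true | true | _ = far₃ G B G∈ B∈ a≢b (y≢a ∘ sym) (y≢b ∘ sym) ga gb gy Ba Bb by
      ... | false | true | false = far₃ (J a c) G ac∈ G∈ a≢c (x≢a ∘ sym) (x≢c ∘ sym)
              (J-left a c (inj₂ Ba)) (J-right a c (inj₁ Ac)) (J-off x≢a x≢c ax bx) ga gc gx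
      ... | true | false | true = far₃ G (J b d) G∈ bd∈ a≢c (y≢a ∘ sym) (y≢c ∘ sym) ga gc gy
              (J-off-false a≢b a≢d (inj₂ Ba)) (J-off-false (b≢c ∘ sym) c≢d (inj₁ Ac)) (J-off y≢b y≢d ay by)
      ... | false | true | true = far₃ G (J a d) G∈ ad∈ b≢c (y≢b ∘ sym) (y≢c ∘ sym) gb gc gy
              (J-off-false (a≢b ∘ sym) b≢d (inj₂ Bb)) (J-off-false (a≢c ∘ sym) c≢d (inj₁ Ac)) (J-off y≢a y≢d ay by)
      ... | true | false | false = far₃ (J b c) G bc∈ G∈ b≢c (x≢b ∘ sym) (x≢c ∘ sym)
              (J-left b c (inj₂ Bb)) (J-right b c (inj₁ Ac)) (J-off x≢b x≢c ax bx) gb gc gx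

  -- Suppose G′ misses some x in `A ∩ B` and G contains some y outside `A ∪ B`. By `no-crossing`
  -- neither member does both, so x and y lie in `G ∖ G′`. Hence G and G′ conflict, and a member
  -- containing y but not x, given by `separating`, is crossing after all.
  star-or-top : ∀ {A B} → A ∈ ℱ → B ∈ ℱ → Quad A B →
    (∀ {G} → G ∈ ℱ → ∀ i → (A ∩ B) ! i ≡ true → G ! i ≡ true) ⊎
    (∀ {G} → G ∈ ℱ → ∀ i → (A ∪ B) ! i ≡ false → G ! i ≡ false)
  star-or-top {A} {B} A∈ B∈ Q with Any.any? (λ G → Fin.any? λ x → (A ∩ B) ! x Bool.≟ true ×-dec G ! x Bool.≟ false) ℱ
  ... | no h = inj₁ λ {G} G∈ i ci → case bool (G ! i) of λ
          { (inj₁ gi) → gi ; (inj₂ gi) → contradiction (lose G∈ (i , ci , gi)) h }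
  ... | yes h with find h
  ...   | G′ , G′∈ , x , cx , g′x = inj₂ top
    where
    open Neighbours A∈ B∈ Q using (no-crossing)
    ax = proj₁ (∩⁻ A B cx)
    bx = proj₂ (∩⁻ A B cx)
    ∪⁻ : ∀ {i} → (A ∪ B) ! i ≡ false → A ! i ≡ false × B ! i ≡ false
    ∪⁻ {i} e rewrite ∪-! A B i with A ! i | B ! i
    ... | false | false = refl , refl
    top : ∀ {G} → G ∈ ℱ → ∀ i → (A ∪ B) ! i ≡ false → G ! i ≡ false
    top {G} G∈ y uy with ∪⁻ uy | bool (G ! y) | bool (G′ ! y) | bool (G ! x)
    ... | _ | inj₂ gy | _ | _ = gy
    ... | ay , by | inj₁ gy | inj₁ g′y | _ = ⊥-elim (no-crossing G′∈ ax bx g′x ay by g′y)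
    ... | ay , by | inj₁ gy | inj₂ g′y | inj₂ gx = ⊥-elim (no-crossing G∈ ax bx gx ay by gy)
    ... | ay , by | inj₁ gy | inj₂ g′y | inj₁ gx = ⊥-elim (cross
            (quad G∈ G′∈ (≢-by A ax ay ∘ sym) gy gx g′y g′x))
      where
      cross : (∃ λ (Q′ : Quad G G′) → Quad.a Q′ ≡ y × Quad.b Q′ ≡ x) → ⊥
      cross (Q′ , refl , refl) with Neighbours.separating G∈ G′∈ Q′
      ... | N , N∈ , ny , nx = no-crossing N∈ ax bx nx ay by ny

-- The graph of an almost intersecting family

-- Stated with an odd bound because K₄ and K₅ yield `s + s ≤ 3` and `s + s ≤ 7`.
half : ∀ {m k} → m + m ≤ suc (k + k) → m ≤ k
half {m} {k} h = ≮⇒≥ λ k<m → <-irrefl refl (begin-strict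
  suc (k + k)      <⟨ ≤-reflexive (cong suc (sym (+-suc k k))) ⟩
  suc k + suc k    ≤⟨ +-mono-≤ k<m k<m ⟩
  m + m            ≤⟨ h ⟩
  suc (k + k)      ∎)
  where open ≤-Reasoning

-- b = false: members arise from β by adding two elements; b = true: by removing two elements.
BaseSize : ℕ → Bool → Subset n → Set
BaseSize t false β = ∣ β ∣ + 2 ≡ t + 1
BaseSize t true  β = ∣ β ∣ ≡ t + 1 + 2

-- For `b = false` this says β ⊆ N, for `b = true` it says N ⊆ β. The elements that may be toggled
-- are those with `β ! i ≡ b`.
Within : Bool → Subset n → Subset n → Set
Within b β N = ∀ i → β ! i ≡ not b → N ! i ≡ not b

two-toggles : ∀ {t} b (β N : Subset n) → BaseSize t b β → ∣ N ∣ ≡ t + 1 → Within b β N →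
  ∃₂ λ u v → u ≢ v × β ! u ≡ b × β ! v ≡ b × N ≡ T β u v
two-toggles {t = t} false β N size ∣N∣ within
  with ≡2⇒two-elements (N ∖ β) (+-cancelˡ-≡ ∣ β ∣ _ _ (trans (∣∖∣-⊆ N β within) (trans ∣N∣ (sym size))))
... | u , v , u≢v , hu , hv , h with ∖⁻ N β hu | ∖⁻ N β hv
...   | nu , βu | nv , βv = u , v , u≢v , βu , βv , T-ext β (trans nu (cong not (sym βu))) (trans nv (cong not (sym βv))) other
  where
  other : ∀ i → i ≢ u → i ≢ v → N ! i ≡ β ! i
  other i p q with β ! i in βi | N ! i in ni
  ... | true | true = refl
  ... | false | false = refl
  ... | true | false = trans (sym ni) (within i βi)
  ... | false | true = trans (sym (∖⁺ N β ni βi)) (h i p q)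
two-toggles {t = t} true β N size ∣N∣ within
  with ≡2⇒two-elements (β ∖ N) (+-cancelˡ-≡ ∣ N ∣ _ _ (trans (∣∖∣-⊆ β N sub) (trans size (cong (_+ 2) (sym ∣N∣)))))
  where
  sub : ∀ i → N ! i ≡ true → β ! i ≡ true
  sub i ni with bool (β ! i)
  ... | inj₁ βi = βi
  ... | inj₂ βi with trans (sym ni) (within i βi)
  ...   | ()
... | u , v , u≢v , hu , hv , h with ∖⁻ β N hu | ∖⁻ β N hv
...   | βu , nu | βv , nv = u , v , u≢v , βu , βv , T-ext β (trans nu (cong not (sym βu))) (trans nv (cong not (sym βv))) other
  where
  other : ∀ i → i ≢ u → i ≢ v → N ! i ≡ β ! i
  other i p q with β ! i in βi | N ! i in ni
  ... | true | true = refl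
  ... | false | false = refl
  ... | true | false = trans (sym (h i p q)) (∖⁺ β N βi ni)
  ... | false | true = trans (sym ni) (within i βi)

Disjoint : Fin n → Fin n → Fin n → Fin n → Set
Disjoint u v w z = u ≢ w × u ≢ z × v ≢ w × v ≢ z

module _ (b : Bool) (β : Subset n) where

  T-in : ∀ {u v} → β ! u ≡ b → T β u v ! u ≡ not b
  T-in {u} {v} βu = trans (T-left β u v) (cong not βu)

  T-in′ : ∀ {u v} → β ! v ≡ b → T β u v ! v ≡ not b
  T-in′ {u} {v} βv = trans (T-right β u v) (cong not βv)

  -- If elements are added, u and v are the two elements of the first set outside the second; if
  -- they are removed, w and z are.
  disjoint⇒conf : ∀ {t u v w z} → ∣ T β u v ∣ ≡ t + 1 → u ≢ v → w ≢ z → β ! u ≡ b → β ! v ≡ b → β ! w ≡ b → β ! z ≡ b →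
    Disjoint u v w z → Conf t (T β u v) (T β w z)
  disjoint⇒conf {t} {u} {v} {w} {z} size u≢v w≢z βu βv βw βz (u≢w , u≢z , v≢w , v≢z) = go b refl
    where
    off-u = T-off β {w} {z} {u} u≢w u≢z
    off-v = T-off β {w} {z} {v} v≢w v≢z
    off-w = T-off β {u} {v} {w} (u≢w ∘ sym) (v≢w ∘ sym)
    off-z = T-off β {u} {v} {z} (u≢z ∘ sym) (v≢z ∘ sym)
    go : ∀ x → b ≡ x → Conf t (T β u v) (T β w z)
    go false b≡ = two⇒conf (T β u v) (T β w z) size u≢v (trans (T-in βu) (cong not b≡)) (trans (T-in′ βv) (cong not b≡))
      (trans off-u (trans βu b≡)) (trans off-v (trans βv b≡))
    go true b≡ = two⇒conf (T β u v) (T β w z) size w≢z (trans off-w (trans βw b≡)) (trans off-z (trans βz b≡))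
      (trans (T-in βw) (cong not b≡)) (trans (T-in′ βz) (cong not b≡))

  -- The first set has at most one element outside the second: v if elements are added, w if they
  -- are removed.
  shared⇒¬conf : ∀ {t u v w} → ∣ T β u v ∣ ≡ t + 1 → u ≢ v → u ≢ w → β ! u ≡ b → β ! v ≡ b → β ! w ≡ b →
    ¬ Conf t (T β u v) (T β u w)
  shared⇒¬conf {t} {u} {v} {w} size u≢v u≢w βu βv βw c with conf⇒two (T β u v) (T β u w) size c
  ... | p , q , p≢q , (p∈ , p∉) , (q∈ , q∉) = go b refl
    where
    i≢u : ∀ {i} → T β u v ! i ≡ true → T β u w ! i ≡ false → i ≢ u
    i≢u h k refl with trans (sym h) (trans (T-in βu) (trans (sym (T-in βu)) k))
    ... | ()
    v-or-w : ∀ {i} → T β u v ! i ≡ true → T β u w ! i ≡ false → i ≡ v ⊎ i ≡ w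
    v-or-w {i} h k with i Fin.≟ v | i Fin.≟ w
    ... | yes e | _ = inj₁ e
    ... | no _ | yes e = inj₂ e
    ... | no e | no f with trans (sym h) (trans (T-off β (i≢u h k) e) (trans (sym (T-off β (i≢u h k) f)) k))
    ...   | ()
    only-v : b ≡ false → ∀ {i} → T β u v ! i ≡ true → T β u w ! i ≡ false → i ≡ v
    only-v b≡ {i} h k with i Fin.≟ v | v-or-w h k
    ... | yes e | _ = e
    ... | no _ | inj₁ e = e
    ... | no e | inj₂ refl with trans (sym h) (trans (T-off β (i≢u h k) e) (trans βw b≡))
    ...   | ()
    only-w : b ≡ true → ∀ {i} → T β u v ! i ≡ true → T β u w ! i ≡ false → i ≡ w
    only-w b≡ {i} h k with v-or-w h k
    ... | inj₂ e = e
    ... | inj₁ refl with trans (sym h) (trans (T-in′ βv) (cong not b≡))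
    ...   | ()
    go : ∀ x → b ≡ x → ⊥
    go false b≡ = p≢q (trans (only-v b≡ p∈ p∉) (sym (only-v b≡ q∈ q∉)))
    go true b≡ = p≢q (trans (only-w b≡ p∈ p∉) (sym (only-w b≡ q∈ q∉)))

  conf⇒disjoint : ∀ {t u v w z} → ∣ T β u v ∣ ≡ t + 1 → u ≢ v → w ≢ z → β ! u ≡ b → β ! v ≡ b → β ! w ≡ b → β ! z ≡ b →
    Conf t (T β u v) (T β w z) → Disjoint u v w z
  conf⇒disjoint {t} {u} {v} {w} {z} size u≢v w≢z βu βv βw βz c =
    (λ { refl → shared⇒¬conf size u≢v w≢z βu βv βz c }) ,
    (λ { refl → shared⇒¬conf size u≢v (w≢z ∘ sym) βu βv βw (flipʳ {T β u v} c) }) ,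
    (λ { refl → shared⇒¬conf size′ (u≢v ∘ sym) w≢z βv βu βz (flipˡ {T β w z} c) }) ,
    (λ { refl → shared⇒¬conf size′ (u≢v ∘ sym) (w≢z ∘ sym) βv βu βw (flipˡ {T β z w} (flipʳ {T β u v} c)) })
    where
    size′ : ∣ T β v u ∣ ≡ t + 1
    size′ = trans (cong ∣_∣ (T-sym β v u)) size
    flipˡ : ∀ {N} → Conf t (T β u v) N → Conf t (T β v u) N
    flipˡ {N} = subst (λ A → Conf t A N) (T-sym β u v)
    flipʳ : ∀ {N} → Conf t N (T β w z) → Conf t N (T β z w)
    flipʳ {N} = subst (Conf t N) (T-sym β w z)

uncurriedT : Subset n → Fin n × Fin n → Subset n
uncurriedT β (u , v) = T β u v

-- Classification of the graphs

module Graph {n t s : ℕ} (ℱ : Family n) (uniq : Unique ℱ) (unif : ∀ {A} → A ∈ ℱ → ∣ A ∣ ≡ t + 1)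
  (almost : AlmostIntersecting s t ℱ) (large : 3 + (s + s) ≤ length ℱ) (larger : s ≡ 1 ⊎ s ≡ 3 → 4 + (s + s) ≤ length ℱ)
  (1≤s : 1 ≤ s) (b : Bool) (β : Subset n) (size : BaseSize t b β) (within : ∀ {N} → N ∈ ℱ → Within b β N) where

  open AlmostIntersectingFamily ℱ uniq unif almost large

  record E (u v : Fin n) : Set where
    constructor edge
    field
      ends≢ : u ≢ v
      βˡ  : β ! u ≡ b
      βʳ  : β ! v ≡ b
      mem : T β u v ∈ ℱ
  open E

  E? : ∀ u v → Dec (E u v)
  E? u v with ¬? (u Fin.≟ v) ×-dec (β ! u Bool.≟ b ×-dec (β ! v Bool.≟ b ×-dec T β u v ∈ˢ? ℱ))
  ... | yes (p , q , r , s) = yes (edge p q r s)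
  ... | no h = no λ (edge p q r s) → h (p , q , r , s)

  E-sym : ∀ {u v} → E u v → E v u
  E-sym {u} {v} (edge p q r s) = edge (p ∘ sym) r q (subst (_∈ ℱ) (T-sym β u v) s)

  edge-of : ∀ {N} → N ∈ ℱ → ∃₂ λ u v → E u v × N ≡ T β u v
  edge-of {N} N∈ with two-toggles b β N size (unif N∈) (within N∈)
  ... | u , v , u≢v , βu , βv , refl = u , v , edge u≢v βu βv N∈ , refl

  E-conf : ∀ {u v w z} → E u v → E w z → Disjoint u v w z → Conf t (T β u v) (T β w z)
  E-conf e f = disjoint⇒conf b β (unif (mem e)) (ends≢ e) (ends≢ f) (βˡ e) (βʳ e) (βˡ f) (βʳ f)

  conflicts≤s : ∀ {A M} → A ∈ ℱ → Unique M → (∀ {N} → N ∈ M → N ∈ ℱ × Conf t A N) → length M ≤ s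
  conflicts≤s {A} A∈ uM h = ≤-trans (unique⊆⇒length≤ uM λ N∈ → let (p , q) = h N∈ in ∈-filter⁺ (conf? t A) p q) (almost A A∈)

  swapˡ : ∀ {u v w z : Fin n} → Disjoint u v w z → Disjoint v u w z
  swapˡ (p , q , r , s) = r , s , p , q

  swapʳ : ∀ {u v w z : Fin n} → Disjoint u v w z → Disjoint u v z w
  swapʳ (p , q , r , s) = q , p , s , r

  swap : ∀ {u v w z : Fin n} → Disjoint u v w z → Disjoint w z u v
  swap (p , q , r , s) = p ∘ sym , r ∘ sym , q ∘ sym , s ∘ sym

  -- The graph form of the four common neighbours: the edges joining ab to cd. Each case carries its
  -- edge, so that an absent edge rules the case out.
  data Cross (a b c d : Fin n) (N : Subset n) : Set where
    ac : E a c → N ≡ T β a c → Cross a b c d N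
    ad : E a d → N ≡ T β a d → Cross a b c d N
    bc : E b c → N ≡ T β b c → Cross a b c d N
    bd : E b d → N ≡ T β b d → Cross a b c d N

  meets : ∀ {a b u v} → E a b → E u v → ¬ Conf t (T β a b) (T β u v) → (u ≡ a ⊎ u ≡ b) ⊎ (v ≡ a ⊎ v ≡ b)
  meets {a} {b} {u} {v} e f ¬c with u Fin.≟ a | u Fin.≟ b | v Fin.≟ a | v Fin.≟ b
  ... | yes p | _ | _ | _ = inj₁ (inj₁ p)
  ... | no _ | yes p | _ | _ = inj₁ (inj₂ p)
  ... | no _ | no _ | yes p | _ = inj₂ (inj₁ p)
  ... | no _ | no _ | no _ | yes p = inj₂ (inj₂ p)
  ... | no p | no q | no r | no s = contradiction (E-conf e f (p ∘ sym , r ∘ sym , q ∘ sym , s ∘ sym)) ¬c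

  -- An edge has only two ends, so meeting both of two disjoint edges means joining them.
  cross : ∀ {a b c d} → E a b → E c d → Disjoint a b c d →
    ∀ {N} → N ∈ ℱ → ¬ Conf t (T β a b) N → ¬ Conf t (T β c d) N → Cross a b c d N
  cross e f (a≢c , a≢d , b≢c , b≢d) N∈ ¬c ¬c′ with edge-of N∈
  ... | u , v , g , refl with meets e g ¬c | meets f g ¬c′
  ...   | inj₁ (inj₁ refl) | inj₁ (inj₁ p) = contradiction p a≢c
  ...   | inj₁ (inj₁ refl) | inj₁ (inj₂ p) = contradiction p a≢d
  ...   | inj₁ (inj₂ refl) | inj₁ (inj₁ p) = contradiction p b≢c
  ...   | inj₁ (inj₂ refl) | inj₁ (inj₂ p) = contradiction p b≢d
  ...   | inj₂ (inj₁ refl) | inj₂ (inj₁ p) = contradiction p a≢c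
  ...   | inj₂ (inj₁ refl) | inj₂ (inj₂ p) = contradiction p a≢d
  ...   | inj₂ (inj₂ refl) | inj₂ (inj₁ p) = contradiction p b≢c
  ...   | inj₂ (inj₂ refl) | inj₂ (inj₂ p) = contradiction p b≢d
  ...   | inj₁ (inj₁ refl) | inj₂ (inj₁ refl) = ac g refl
  ...   | inj₁ (inj₁ refl) | inj₂ (inj₂ refl) = ad g refl
  ...   | inj₁ (inj₂ refl) | inj₂ (inj₁ refl) = bc g refl
  ...   | inj₁ (inj₂ refl) | inj₂ (inj₂ refl) = bd g refl
  ...   | inj₂ (inj₁ refl) | inj₁ (inj₁ refl) = ac (E-sym g) (T-sym β _ _)
  ...   | inj₂ (inj₁ refl) | inj₁ (inj₂ refl) = ad (E-sym g) (T-sym β _ _)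
  ...   | inj₂ (inj₂ refl) | inj₁ (inj₁ refl) = bc (E-sym g) (T-sym β _ _)
  ...   | inj₂ (inj₂ refl) | inj₁ (inj₂ refl) = bd (E-sym g) (T-sym β _ _)

  -- Graph form of `few⇒⊥`: two disjoint edges are joined by at least three edges, plus one for
  -- every edge disjoint from both.
  squeeze : ∀ {a b c d} → E a b → E c d → Disjoint a b c d → (L M : List (Subset n)) → (∀ {N} → Cross a b c d N → N ∈ L) →
    Unique M → (∀ {N} → N ∈ M → ∃₂ λ u v → E u v × N ≡ T β u v × Disjoint a b u v × Disjoint c d u v) →
    length L < 3 + length M → ⊥
  squeeze {a} {b} {c} {d} e f D L M hL uM hM lt =
    few⇒⊥ {L} {M} lt (cover (mem e) (mem f) L M (λ N∈ x y → hL (cross e f D N∈ x y)) uM both)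
    where
    both : ∀ {N} → N ∈ M → N ∈ ℱ × Conf t (T β a b) N × Conf t (T β c d) N
    both N∈ with hM N∈
    ... | u , v , g , refl , D₁ , D₂ = mem g , E-conf e g D₁ , E-conf f g D₂

  -- At most one joining edge is absent. `fork` uses this for two joining edges that share an end,
  -- `opposite` for two that share none.
  fork : ∀ {a b c d} → E a b → E c d → Disjoint a b c d → E a c ⊎ E a d
  fork {a} {b} {c} {d} e f D with E? a c | E? a d
  ... | yes g | _ = inj₁ g
  ... | no _ | yes g = inj₂ g
  ... | no ¬ac | no ¬ad = ⊥-elim (squeeze e f D (T β b c ∷ T β b d ∷ []) [] (λ
    { (ac g _) → contradiction g ¬ac ; (ad g _) → contradiction g ¬ad ; (bc _ p) → here p ; (bd _ p) → there (here p) })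
    [] (λ ()) ≤-refl)

  opposite : ∀ {a b c d} → E a b → E c d → Disjoint a b c d → E a c ⊎ E b d
  opposite {a} {b} {c} {d} e f D with E? a c | E? b d
  ... | yes g | _ = inj₁ g
  ... | no _ | yes g = inj₂ g
  ... | no ¬ac | no ¬bd = ⊥-elim (squeeze e f D (T β a d ∷ T β b c ∷ []) [] (λ
    { (ac g _) → contradiction g ¬ac ; (bd g _) → contradiction g ¬bd ; (ad _ p) → here p ; (bc _ p) → there (here p) })
    [] (λ ()) ≤-refl)

  -- A third edge disjoint from both raises the demand to all four joining edges.
  third : ∀ {a b c d e f} → E a b → E c d → E e f → Disjoint a b c d → Disjoint a b e f → Disjoint c d e f → E a c
  third {a} {b} {c} {d} {e} {f} x y z D D₁ D₂ with E? a c
  ... | yes g = g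
  ... | no ¬ac = ⊥-elim (squeeze x y D (T β a d ∷ T β b c ∷ T β b d ∷ []) (T β e f ∷ []) (λ
    { (ac g _) → contradiction g ¬ac ; (ad _ p) → here p ; (bc _ p) → there (here p) ; (bd _ p) → there (there (here p)) })
    ([] ∷ []) (λ { (here refl) → e , f , z , refl , D₁ , D₂ }) ≤-refl)

  -- Two further edges would demand five joining edges, and there are only four.
  no-fourth : ∀ {a b c d e f g h} → E a b → E c d → E e f → E g h → T β e f ≢ T β g h →
    Disjoint a b c d → Disjoint a b e f → Disjoint c d e f → Disjoint a b g h → Disjoint c d g h → ⊥
  no-fourth {a} {b} {c} {d} {e} {f} {g} {h} x y z w ne D D₁ D₂ D₃ D₄ =
    squeeze x y D (T β a c ∷ T β a d ∷ T β b c ∷ T β b d ∷ []) (T β e f ∷ T β g h ∷ []) (λ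
    { (ac _ p) → here p ; (ad _ p) → there (here p) ; (bc _ p) → there (there (here p)) ; (bd _ p) → there (there (there (here p))) })
    ((ne ∷ []) ∷ [] ∷ []) (λ { (here refl) → e , f , z , refl , D₁ , D₂ ; (there (here refl)) → g , h , w , refl , D₃ , D₄ }) ≤-refl

  three-of-four : ∀ {a b c d} → E a b → E c d → Disjoint a b c d → ¬ E b c → E a c × E a d × E b d
  three-of-four e f D ¬bc = E-sym (pick (fork f e (swap D)) (¬bc ∘ E-sym)) , pick (opposite e (E-sym f) (swapʳ D)) ¬bc ,
    pick′ (fork (E-sym e) f (swapˡ D)) ¬bc
    where
    pick : ∀ {P Q : Set} → P ⊎ Q → ¬ Q → P
    pick (inj₁ p) _ = p
    pick (inj₂ q) h = contradiction q h
    pick′ : ∀ {P Q : Set} → P ⊎ Q → ¬ P → Q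
    pick′ (inj₁ p) h = contradiction p h
    pick′ (inj₂ q) _ = q

  -- In `join`, `V` is the set of isolated vertices joined to the edge ad. That graph has 2s + 3
  -- edges, one short of what `larger` requires for s = 1 and s = 3.
  data Shape : Set where
    complete : (W : List (Fin n)) → AllPairs E W → (∀ {w} → w ∈ W → β ! w ≡ b) → (∀ {u v} → E u v → u ∈ W) →
      length W ≡ 4 × s ≡ 1 ⊎ length W ≡ 5 × s ≡ 3 ⊎ length W ≡ 6 × s ≡ 6 → Shape
    join : (a d : Fin n) (V : List (Fin n)) → Unique (a ∷ d ∷ V) → length V ≡ suc s → E a d →
      (∀ {v} → v ∈ V → E a v × E d v) → (∀ {u v} → E u v → u ∈ a ∷ d ∷ V) → (∀ {u v} → E u v → (u ≡ a ⊎ u ≡ d) ⊎ (v ≡ a ⊎ v ≡ d)) →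
      s ≢ 1 → s ≢ 3 → Shape

  edges⊆pairs : (W : List (Fin n)) → (∀ {u v} → E u v → u ∈ W) → ∀ {N} → N ∈ ℱ → ∃₂ λ u v → E u v × N ≡ T β u v × (u , v) ∈ pairs W
  edges⊆pairs W h N∈ with edge-of N∈
  ... | u , v , e , refl with ∈-pairs (h e) (h (E-sym e)) (ends≢ e)
  ...   | inj₁ p = u , v , e , refl , p
  ...   | inj₂ p = v , u , E-sym e , T-sym β u v , p

  complete-upper : (W : List (Fin n)) → (∀ {u v} → E u v → u ∈ W) → length ℱ ≤ length (pairs W)
  complete-upper W h = subst (length ℱ ≤_) (length-map (uncurriedT β) (pairs W))
    (unique⊆⇒length≤ uniq λ N∈ → let (u , v , _ , eq , p) = edges⊆pairs W h N∈ in subst (_∈ _) (sym eq) (∈-map⁺ (uncurriedT β) p))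

  -- All edges of the clique `W` are disjoint from xy and hence conflict with it.
  complete-lower : ∀ {x y W} → E x y → AllPairs E W → All (x ≢_) W → All (y ≢_) W → length (pairs W) ≤ s
  complete-lower {x} {y} {W} e h x∉ y∉ = subst (_≤ s) (length-map (uncurriedT β) (pairs W))
    (conflicts≤s (mem e) (T-pairs-unique β (AllPairs.map ends≢ h)) good)
    where
    good : ∀ {N} → N ∈ map (uncurriedT β) (pairs W) → N ∈ ℱ × Conf t (T β x y) N
    good N∈ with ∈-map⁻ (uncurriedT β) N∈
    ... | (w , z) , p , refl with pairs⇒AllPairs h p
    ...   | f , w∈ , z∈ = mem f , E-conf e f (All.lookup x∉ w∈ , All.lookup x∉ z∈ , All.lookup y∉ w∈ , All.lookup y∉ z∈)

  Outside : (a b c d e : Fin n) → Set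
  Outside a b c d e = e ≢ a × e ≢ b × e ≢ c × e ≢ d

  Outside? : ∀ a b c d e → Dec (Outside a b c d e)
  Outside? a b c d e = ¬? (e Fin.≟ a) ×-dec (¬? (e Fin.≟ b) ×-dec (¬? (e Fin.≟ c) ×-dec ¬? (e Fin.≟ d)))

  data Position (a b c d e : Fin n) : Set where
    is-a : e ≡ a → Position a b c d e
    is-b : e ≡ b → Position a b c d e
    is-c : e ≡ c → Position a b c d e
    is-d : e ≡ d → Position a b c d e
    out  : Outside a b c d e → Position a b c d e

  position : ∀ a b c d e → Position a b c d e
  position a b c d e with e Fin.≟ a | e Fin.≟ b | e Fin.≟ c | e Fin.≟ d
  ... | yes p | _ | _ | _ = is-a p
  ... | no _ | yes p | _ | _ = is-b p
  ... | no _ | no _ | yes p | _ = is-c p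
  ... | no _ | no _ | no _ | yes p = is-d p
  ... | no p | no q | no r | no s = out (p , q , r , s)

  -- Two disjoint edges ab, cd spanning K₄ minus the edge bc.
  module MissingEdge {a b c d : Fin n} (a-b : E a b) (c-d : E c d) (D : Disjoint a b c d) (¬b-c : ¬ E b c) where
    a≢b = ends≢ a-b
    c≢d = ends≢ c-d
    a≢c = proj₁ D
    a≢d = proj₁ (proj₂ D)
    b≢c = proj₁ (proj₂ (proj₂ D))
    b≢d = proj₂ (proj₂ (proj₂ D))
    a-c = proj₁ (three-of-four a-b c-d D ¬b-c)
    a-d = proj₁ (proj₂ (three-of-four a-b c-d D ¬b-c))
    b-d = proj₂ (proj₂ (three-of-four a-b c-d D ¬b-c))

    module _ {e : Fin n} (o : Outside a b c d e) where
      e≢a = proj₁ o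
      e≢b = proj₁ (proj₂ o)
      e≢c = proj₁ (proj₂ (proj₂ o))
      e≢d = proj₂ (proj₂ (proj₂ o))

      -- The disjoint edges eb and cd lack the same joining edge bc, so their other three are
      -- present. In `c⇒ba` the edges ec and ba play this role.
      b⇒cd : E e b → E e c × E e d
      b⇒cd e-b with three-of-four e-b c-d (e≢c , e≢d , b≢c , b≢d) ¬b-c
      ... | p , q , _ = p , q

      c⇒ba : E e c → E e b × E e a
      c⇒ba e-c with three-of-four e-c (E-sym a-b) (e≢b , e≢a , b≢c ∘ sym , a≢c ∘ sym) (¬b-c ∘ E-sym)
      ... | p , q , _ = p , q

      a⇒b⊎d : E e a → E e b ⊎ E e d
      a⇒b⊎d e-a = fork e-a b-d (e≢b , e≢d , a≢b , a≢d)

      d⇒a⊎c : E e d → E e a ⊎ E e c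
      d⇒a⊎c e-d = fork e-d a-c (e≢a , e≢c , a≢d ∘ sym , c≢d ∘ sym)

      -- An edge disjoint from both ab and cd would force bc by `third`.
      inner : ∀ {f} → E e f → ¬ Outside a b c d f
      inner e-f (f≢a , f≢b , f≢c , f≢d) = ¬b-c (third (E-sym a-b) c-d e-f (swapˡ D)
        (e≢b ∘ sym , f≢b ∘ sym , e≢a ∘ sym , f≢a ∘ sym) (e≢c ∘ sym , f≢c ∘ sym , e≢d ∘ sym , f≢d ∘ sym))

      -- Identifies `a` as an end of the central edge of the join: it is adjacent to every outside
      -- vertex that lies on an edge.
      edge⇒a : ∀ {f} → E e f → E e a
      edge⇒a {f} e-f with position a b c d f
      ... | is-a refl = e-f
      ... | is-b refl = proj₂ (c⇒ba (proj₁ (b⇒cd e-f)))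
      ... | is-c refl = proj₂ (c⇒ba e-f)
      ... | is-d refl with d⇒a⊎c e-f
      ...   | inj₁ e-a = e-a
      ...   | inj₂ e-c = proj₂ (c⇒ba e-c)
      edge⇒a e-f | out o′ = contradiction o′ (inner e-f)

    -- An outside neighbour of b would make the graph K₅ minus an edge.
    ¬b-out : ∀ {e} → Outside a b c d e → ¬ E e b
    ¬b-out {e} o e-b = <-irrefl refl (≤-trans ten≤ ≤9)
      where
      W : List (Fin n)
      -- Starting with b and c makes the missing edge the head of `pairs W`; dropping it leaves nine
      -- of the ten pairs.
      W = b ∷ c ∷ a ∷ d ∷ e ∷ []
      covered : ∀ {u v} → E u v → u ∈ W
      covered {u} u-v with position a b c d u | u Fin.≟ e
      ... | is-a p | _ = there (there (here p))
      ... | is-b p | _ = here p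
      ... | is-c p | _ = there (here p)
      ... | is-d p | _ = there (there (there (here p)))
      ... | out o′ | yes p = there (there (there (there (here p))))
      -- A sixth vertex u would be adjacent to a, and ua is disjoint from be and cd, which forces
      -- bc.
      ... | out o′@(u≢a , u≢b , u≢c , u≢d) | no u≢e = ⊥-elim (¬b-c (third (E-sym e-b) c-d (edge⇒a o′ u-v)
        (b≢c , b≢d , e≢c o , e≢d o) (u≢b ∘ sym , a≢b ∘ sym , u≢e ∘ sym , e≢a o) (u≢c ∘ sym , a≢c ∘ sym , u≢d ∘ sym , a≢d ∘ sym)))
      L : List (Subset n)
      L = map (uncurriedT β) (drop 1 (pairs W))
      ≤9 : length ℱ ≤ 9
      ≤9 = unique⊆⇒length≤ {ys = L} uniq sub
        where
        sub : ∀ {N} → N ∈ ℱ → N ∈ L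
        sub N∈ with edges⊆pairs W covered N∈
        ... | u , v , u-v , refl , here refl = contradiction u-v ¬b-c
        ... | u , v , u-v , refl , there p = ∈-map⁺ (uncurriedT β) p
      3≤s : 3 ≤ s
      3≤s = complete-lower e-b ((a-c ∷ a-d ∷ []) ∷ (c-d ∷ []) ∷ [] ∷ []) (e≢a o ∷ e≢c o ∷ e≢d o ∷ []) (a≢b ∘ sym ∷ b≢c ∷ b≢d ∷ [])
      s≤3 : s ≤ 3
      s≤3 = half (≤-trans (+-cancelˡ-≤ 3 _ _ (≤-trans large ≤9)) (n≤1+n 6))
      ten≤ : 10 ≤ length ℱ
      -- Now s = 3, the case in which ten members are guaranteed.
      ten≤ = ≤-trans (+-monoʳ-≤ 4 (+-mono-≤ 3≤s 3≤s)) (larger (inj₂ (≤-antisym s≤3 3≤s)))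

    P? = λ v → E? a v ×-dec (¬? (v Fin.≟ d) ×-dec ¬? (v Fin.≟ b))

    -- The isolated vertices of the join are b together with `V`. Keeping b apart makes every edge
    -- dv with v in `V` disjoint from ab, which bounds `length V` by s.
    V : List (Fin n)
    V = filter P? (allFin n)

    ∈V⁺ : ∀ {v} → E a v → v ≢ d → v ≢ b → v ∈ V
    ∈V⁺ p q r = ∈-filter⁺ P? (∈-allFin _) (p , q , r)

    ∈V⁻ : ∀ {v} → v ∈ V → E a v × v ≢ d × v ≢ b
    ∈V⁻ v∈ = proj₂ (∈-filter⁻ P? {xs = allFin n} v∈)

    out-a⇒d : ∀ {e} → Outside a b c d e → E e a → E e d
    out-a⇒d o e-a with a⇒b⊎d o e-a
    ... | inj₁ e-b = contradiction e-b (¬b-out o)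
    ... | inj₂ e-d = e-d

    V⇒d : ∀ {v} → v ∈ V → E d v
    V⇒d {v} v∈ with ∈V⁻ v∈ | position a b c d v
    ... | a-v , v≢d , v≢b | is-a refl = contradiction refl (ends≢ a-v)
    ... | a-v , v≢d , v≢b | is-b p = contradiction p v≢b
    ... | a-v , v≢d , v≢b | is-c refl = E-sym c-d
    ... | a-v , v≢d , v≢b | is-d p = contradiction p v≢d
    ... | a-v , v≢d , v≢b | out o = E-sym (out-a⇒d o (E-sym a-v))

    touch : ∀ {u v} → E u v → (u ≡ a ⊎ u ≡ d) ⊎ (v ≡ a ⊎ v ≡ d)
    touch {u} {v} u-v with position a b c d u | position a b c d v
    ... | is-a p | _ = inj₁ (inj₁ p)
    ... | is-d p | _ = inj₁ (inj₂ p)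
    ... | _ | is-a p = inj₂ (inj₁ p)
    ... | _ | is-d p = inj₂ (inj₂ p)
    ... | is-b refl | is-b refl = contradiction refl (ends≢ u-v)
    ... | is-b refl | is-c refl = contradiction u-v ¬b-c
    ... | is-b refl | out o = contradiction (E-sym u-v) (¬b-out o)
    ... | is-c refl | is-b refl = contradiction (E-sym u-v) ¬b-c
    ... | is-c refl | is-c refl = contradiction refl (ends≢ u-v)
    ... | is-c refl | out o = contradiction (proj₁ (c⇒ba o (E-sym u-v))) (¬b-out o)
    ... | out o | is-b refl = contradiction u-v (¬b-out o)
    ... | out o | is-c refl = contradiction (proj₁ (c⇒ba o u-v)) (¬b-out o)
    ... | out o | out o′ = contradiction o′ (inner o u-v)

    covered : ∀ {u v} → E u v → u ∈ a ∷ d ∷ b ∷ V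
    covered {u} u-v with position a b c d u
    ... | is-a p = here p
    ... | is-d p = there (here p)
    ... | is-b p = there (there (here p))
    ... | is-c refl = there (there (there (∈V⁺ a-c c≢d (b≢c ∘ sym))))
    ... | out o = there (there (there (∈V⁺ (E-sym (edge⇒a o u-v)) (e≢d o) (e≢b o))))

    m = length V

    -- The edge ad and the two rows from a and from d to `b ∷ V` account for all edges.
    upper : length ℱ ≤ 3 + (m + m)
    upper = begin
      length ℱ
        ≤⟨ unique⊆⇒length≤ uniq sub ⟩
      length L
        ≡⟨ cong suc (length-++ (map (T β a) (b ∷ V))) ⟩
      1 + (length (map (T β a) (b ∷ V)) + length (map (T β d) (b ∷ V)))
        ≡⟨ cong suc (cong₂ _+_ (length-map (T β a) (b ∷ V)) (length-map (T β d) (b ∷ V))) ⟩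
      1 + (suc m + suc m)
        ≡⟨ cong (2 +_) (+-suc m m) ⟩
      3 + (m + m) ∎
      where
      open ≤-Reasoning
      L = T β a d ∷ map (T β a) (b ∷ V) ++ map (T β d) (b ∷ V)
      row : ∀ {u v} → u ≡ a ⊎ u ≡ d → v ∈ a ∷ d ∷ b ∷ V → u ≢ v → T β u v ∈ L
      row (inj₁ refl) (here refl) ne = contradiction refl ne
      row (inj₁ refl) (there (here refl)) ne = here refl
      row (inj₁ refl) (there (there v∈)) ne = there (∈-++⁺ˡ (∈-map⁺ (T β a) v∈))
      row (inj₂ refl) (here refl) ne = here (T-sym β d a)
      row (inj₂ refl) (there (here refl)) ne = contradiction refl ne
      row (inj₂ refl) (there (there v∈)) ne = there (∈-++⁺ʳ (map (T β a) (b ∷ V)) (∈-map⁺ (T β d) v∈))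
      sub : ∀ {N} → N ∈ ℱ → N ∈ L
      sub N∈ with edge-of N∈
      ... | u , v , u-v , refl with touch u-v
      ...   | inj₁ p = row p (covered (E-sym u-v)) (ends≢ u-v)
      ...   | inj₂ p = subst (_∈ L) (T-sym β v u) (row p (covered u-v) (ends≢ u-v ∘ sym))

    d∉V : All (d ≢_) V
    d∉V = All.tabulate λ v∈ → ends≢ (V⇒d v∈)

    V-unique : Unique V
    V-unique = Unique.filter⁺ P? (Unique.allFin⁺ n)

    m≤s : m ≤ s
    m≤s = subst (_≤ s) (length-map (T β d) V) (conflicts≤s (mem a-b) (T-row-unique β d d∉V V-unique) good)
      where
      good : ∀ {N} → N ∈ map (T β d) V → N ∈ ℱ × Conf t (T β a b) N
      good N∈ with ∈-map⁻ (T β d) N∈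
      ... | v , v∈ , refl with ∈V⁻ v∈
      ...   | a-v , _ , v≢b = mem (V⇒d v∈) , E-conf a-b (V⇒d v∈) (a≢d , ends≢ a-v , b≢d , v≢b ∘ sym)

    s≤m : s ≤ m
    s≤m = half (m≤n⇒m≤1+n (+-cancelˡ-≤ 3 _ _ (≤-trans large upper)))

    not-larger : ¬ (s ≡ 1 ⊎ s ≡ 3)
    not-larger h = <-irrefl refl (≤-trans (larger h) (≤-trans upper (+-monoʳ-≤ 3 (+-mono-≤ m≤s m≤s))))

    shape : Shape
    shape = join a d (b ∷ V)
      ((ends≢ a-d ∷ a≢b ∷ All.tabulate (λ v∈ → ends≢ (proj₁ (∈V⁻ v∈)))) ∷ (b≢d ∘ sym ∷ d∉V) ∷
        All.tabulate (λ v∈ → proj₂ (proj₂ (∈V⁻ v∈)) ∘ sym) ∷ V-unique)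
      (cong suc (≤-antisym m≤s s≤m)) a-d
      (λ { (here refl) → a-b , E-sym b-d ; (there v∈) → proj₁ (∈V⁻ v∈) , V⇒d v∈ })
      covered touch (not-larger ∘ inj₁) (not-larger ∘ inj₂)

  -- Naming the single edge bc suffices: reversing ab or cd turns it into any of the four joining
  -- edges.
  module NoMissingEdge (full : ∀ {a b c d} → E a b → E c d → Disjoint a b c d → E b c) where

    spread : ∀ {a b c d e} → E a b → E c d → Disjoint a b c d → Outside a b c d e → E e a → E e a × E e b × E e c × E e d
    spread a-b c-d (a≢c , a≢d , b≢c , b≢d) (e≢a , e≢b , e≢c , e≢d) e-a = e-a , e-b , e-c , e-d
      where
      e-c = full (E-sym e-a) c-d (a≢c , a≢d , e≢c , e≢d)
      e-d = full (E-sym e-a) (E-sym c-d) (a≢d , a≢c , e≢d , e≢c)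
      e-b = full (E-sym e-c) (E-sym a-b) (b≢c ∘ sym , a≢c ∘ sym , e≢b , e≢a)

    -- If the edge ef avoids a, b, c, d, then `full` applied to it and ab yields the edge ea, and
    -- `spread` applies again.
    attach : ∀ {a b c d e f} → E a b → E c d → Disjoint a b c d → Outside a b c d e → E e f → E e a × E e b × E e c × E e d
    attach {a} {b} {c} {d} {e} {f} a-b c-d D o@(e≢a , e≢b , e≢c , e≢d) e-f with position a b c d f
    ... | is-a refl = spread a-b c-d D o e-f
    ... | is-b refl = let (p , q , r , s) = spread (E-sym a-b) c-d (swapˡ D) (e≢b , e≢a , e≢c , e≢d) e-f in q , p , r , s
    ... | is-c refl = let (p , q , r , s) = spread c-d a-b (swap D) (e≢c , e≢d , e≢a , e≢b) e-f in r , s , p , q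
    ... | is-d refl = let (p , q , r , s) = spread (E-sym c-d) a-b (swapˡ (swap D)) (e≢d , e≢c , e≢a , e≢b) e-f in r , s , q , p
    ... | out (f≢a , f≢b , f≢c , f≢d) = spread a-b c-d D o (full (E-sym e-f) a-b (f≢a , f≢b , e≢a , e≢b))

    module _ {a b c d : Fin n} (a-b : E a b) (c-d : E c d) (D : Disjoint a b c d) where

      a≢c = proj₁ D
      a≢d = proj₁ (proj₂ D)
      b≢c = proj₁ (proj₂ (proj₂ D))
      b≢d = proj₂ (proj₂ (proj₂ D))
      b-c = full a-b c-d D
      a-c = full (E-sym a-b) c-d (swapˡ D)
      a-d = full (E-sym a-b) (E-sym c-d) (swapʳ (swapˡ D))
      b-d = full a-b (E-sym c-d) (swapʳ D)

      K₄ : AllPairs E (a ∷ b ∷ c ∷ d ∷ [])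
      K₄ = (a-b ∷ a-c ∷ a-d ∷ []) ∷ (b-c ∷ b-d ∷ []) ∷ (c-d ∷ []) ∷ [] ∷ []

      -- Elements on no edge are not vertices of the graph: no member toggles them.
      Active : (Fin n → Set) → Set
      Active P = ∃ λ e → P e × ∃ λ f → E e f

      active? : {P : Fin n → Set} → (∀ e → Dec (P e)) → Dec (Active P)
      active? P? = Fin.any? λ e → P? e ×-dec Fin.any? (E? e)

      -- The clique grows from K₄ by one vertex at a time. Its 6, 10 or 15 edges against
      -- `∣ℱ∣ ≥ 2s + 3` give s ≤ 1, 3, 6; the clique left after removing a and b gives s ≥ 3 for K₅
      -- and s ≥ 6 for K₆.
      shape : Shape
      shape with active? (Outside? a b c d)
      ... | no none = complete _ K₄ (All.lookup (βˡ a-b ∷ βʳ a-b ∷ βˡ c-d ∷ βʳ c-d ∷ [])) covered (inj₁ (refl , ≤-antisym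
              (half (+-cancelˡ-≤ 3 _ _ (≤-trans large (complete-upper _ covered)))) 1≤s))
        where
        covered : ∀ {u v} → E u v → u ∈ a ∷ b ∷ c ∷ d ∷ []
        covered {u} u-v with position a b c d u
        ... | is-a p = here p
        ... | is-b p = there (here p)
        ... | is-c p = there (there (here p))
        ... | is-d p = there (there (there (here p)))
        ... | out o = contradiction (u , o , _ , u-v) none
      ... | yes (e , oe@(e≢a , e≢b , e≢c , e≢d) , _ , e-x) with attach a-b c-d D oe e-x
      ...   | e-a , e-b , e-c , e-d with active? (λ f → Outside? a b c d f ×-dec ¬? (f Fin.≟ e))
      ...     | no none = complete _ K₅
                (All.lookup (βˡ e-a ∷ βˡ a-b ∷ βʳ a-b ∷ βˡ c-d ∷ βʳ c-d ∷ [])) covered (inj₂ (inj₁ (refl , ≤-antisym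
                  (half (+-cancelˡ-≤ 3 _ _ (≤-trans large (complete-upper _ covered))))
                  (complete-lower a-b ((e-c ∷ e-d ∷ []) ∷ (c-d ∷ []) ∷ [] ∷ [])
                    (e≢a ∘ sym ∷ a≢c ∷ a≢d ∷ []) (e≢b ∘ sym ∷ b≢c ∷ b≢d ∷ [])))))
        where
        K₅ : AllPairs E (e ∷ a ∷ b ∷ c ∷ d ∷ [])
        K₅ = (e-a ∷ e-b ∷ e-c ∷ e-d ∷ []) ∷ K₄
        covered : ∀ {u v} → E u v → u ∈ e ∷ a ∷ b ∷ c ∷ d ∷ []
        covered {u} u-v with position a b c d u | u Fin.≟ e
        ... | is-a p | _ = there (here p)
        ... | is-b p | _ = there (there (here p))
        ... | is-c p | _ = there (there (there (here p)))
        ... | is-d p | _ = there (there (there (there (here p))))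
        ... | out o | yes p = here p
        ... | out o | no p = contradiction (u , (o , p) , _ , u-v) none
      ...     | yes (f , (of@(f≢a , f≢b , f≢c , f≢d) , f≢e) , _ , f-x) with attach a-b c-d D of f-x
      ...       | f-a , f-b , f-c , f-d = complete _ K₆
                  (All.lookup (βˡ f-a ∷ βˡ e-a ∷ βˡ a-b ∷ βʳ a-b ∷ βˡ c-d ∷ βʳ c-d ∷ [])) covered (inj₂ (inj₂ (refl , ≤-antisym
                    (half (+-cancelˡ-≤ 3 _ _ (m≤n⇒m≤1+n (≤-trans large (complete-upper _ covered)))))
                    (complete-lower a-b ((f-e ∷ f-c ∷ f-d ∷ []) ∷ (e-c ∷ e-d ∷ []) ∷ (c-d ∷ []) ∷ [] ∷ [])
                      (f≢a ∘ sym ∷ e≢a ∘ sym ∷ a≢c ∷ a≢d ∷ []) (f≢b ∘ sym ∷ e≢b ∘ sym ∷ b≢c ∷ b≢d ∷ [])))))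
        where
        -- `fb` and `ea` are disjoint edges, and `fe` is one of the edges joining them.
        f-e : E f e
        f-e = full (E-sym f-b) (e-a) (e≢b ∘ sym , ends≢ a-b ∘ sym , f≢e , f≢a)
        K₆ : AllPairs E (f ∷ e ∷ a ∷ b ∷ c ∷ d ∷ [])
        K₆ = (f-e ∷ f-a ∷ f-b ∷ f-c ∷ f-d ∷ []) ∷ (e-a ∷ e-b ∷ e-c ∷ e-d ∷ []) ∷ K₄
        covered : ∀ {u v} → E u v → u ∈ f ∷ e ∷ a ∷ b ∷ c ∷ d ∷ []
        covered {u} u-v with position a b c d u | u Fin.≟ e | u Fin.≟ f
        ... | is-a p | _ | _ = there (there (here p))
        ... | is-b p | _ | _ = there (there (there (here p)))
        ... | is-c p | _ | _ = there (there (there (there (here p))))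
        ... | is-d p | _ | _ = there (there (there (there (there (here p)))))
        ... | out o | yes p | _ = there (here p)
        ... | out o | no _ | yes p = here p
        -- With a seventh vertex u, both ab and ua would be disjoint from cd and from fe.
        ... | out o@(u≢a , u≢b , u≢c , u≢d) | no u≢e | no u≢f = ⊥-elim (no-fourth c-d f-e a-b (proj₁ (attach a-b c-d D o u-v))
          (T-distinct β {b} {a} (u≢b ∘ sym) (ends≢ a-b ∘ sym) ∘ trans (T-sym β b a))
          (f≢c ∘ sym , e≢c ∘ sym , f≢d ∘ sym , e≢d ∘ sym) (swap D) (f≢a , f≢b , e≢a , e≢b)
          (u≢c ∘ sym , a≢c ∘ sym , u≢d ∘ sym , a≢d ∘ sym) (u≢f ∘ sym , f≢a , u≢e ∘ sym , e≢a))

  classify : ∀ {A B} → A ∈ ℱ → B ∈ ℱ → Conf t A B → Shape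
  classify A∈ B∈ c with edge-of A∈ | edge-of B∈
  -- The search runs over all ordered labellings, so absence of the one joining edge qr covers every
  -- way of lacking one.
  ... | _ , _ , a-b , refl | _ , _ , c-d , refl with Fin.any? (λ p → Fin.any? λ q → Fin.any? λ r → Fin.any? λ z →
          E? p q ×-dec (E? r z ×-dec
          ((¬? (p Fin.≟ r) ×-dec (¬? (p Fin.≟ z) ×-dec (¬? (q Fin.≟ r) ×-dec ¬? (q Fin.≟ z)))) ×-dec ¬? (E? q r))))
  ...   | yes (_ , _ , _ , _ , p-q , r-z , D , ¬q-r) = MissingEdge.shape p-q r-z D ¬q-r
  ...   | no none = NoMissingEdge.shape
    (λ {p} {q} {r} {z} p-q r-z D → decidable-stable (E? q r) λ ¬q-r → none (p , q , r , z , p-q , r-z , D , ¬q-r))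
    a-b c-d (conf⇒disjoint b β (unif (mem a-b)) (ends≢ a-b) (ends≢ c-d) (βˡ a-b) (βʳ a-b) (βˡ c-d) (βʳ c-d) c)

-- Permutations onto initial segments

<⇒<ᵇ≡ : ∀ {m k} → m < k → (m <ᵇ k) ≡ true
<⇒<ᵇ≡ h = Equivalence.to Bool.T-≡ (<⇒<ᵇ h)

<ᵇ≡⇒< : ∀ m k → (m <ᵇ k) ≡ true → m < k
<ᵇ≡⇒< m k h = <ᵇ⇒< m k (Equivalence.from Bool.T-≡ h)

-- Inserting a new position p shifts exactly the positions from p on: an initial segment reaching p
-- grows by one, one ending before p keeps its length (`punchIn-<ᵇ`).
punchIn-<ᵇ-suc : (p : Fin (suc n)) (x : Fin n) (m : ℕ) → toℕ p ≤ m → (toℕ (punchIn p x) <ᵇ suc m) ≡ (toℕ x <ᵇ m)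
punchIn-<ᵇ-suc Fin.zero x m _ = refl
punchIn-<ᵇ-suc (Fin.suc p) Fin.zero (suc m) _ = refl
punchIn-<ᵇ-suc (Fin.suc p) (Fin.suc x) (suc m) (s≤s h) = punchIn-<ᵇ-suc p x m h

punchIn-<ᵇ : (p : Fin (suc n)) (x : Fin n) (m : ℕ) → m ≤ toℕ p → (toℕ (punchIn p x) <ᵇ m) ≡ (toℕ x <ᵇ m)
punchIn-<ᵇ p x zero _ = refl
punchIn-<ᵇ (Fin.suc p) Fin.zero (suc m) _ = refl
punchIn-<ᵇ (Fin.suc p) (Fin.suc x) (suc m) (s≤s h) = punchIn-<ᵇ p x m h

below : (Fin n → ℕ) → ℕ → Subset n
below k c = tabulate λ i → k i <ᵇ c

cnt : (Fin n → ℕ) → ℕ → ℕ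
cnt k c = ∣ below k c ∣

cnt-mono : (k : Fin n → ℕ) (c c′ : ℕ) → c ≤ c′ → cnt k c ≤ cnt k c′
cnt-mono k c c′ h = Subset.p⊆q⇒∣p∣≤∣q∣ {p = below k c} {q = below k c′} λ {i} i∈ →
  lookup⇒[]= i (below k c′) (trans (lookup∘tabulate _ i)
  (<⇒<ᵇ≡ (<-≤-trans (<ᵇ≡⇒< (k i) c (trans (sym (lookup∘tabulate _ i)) ([]=⇒lookup i∈))) h)))

-- Sorts by the label `k`, so that every set of elements with label below c becomes an initial
-- segment. In the induction the first element is inserted right behind all later elements of
-- strictly smaller label.
sorting-permutation : (k : Fin n → ℕ) → ∃ λ (σ : Permutation′ n) → ∀ i c → (toℕ (σ ⟨$⟩ʳ i) <ᵇ cnt k c) ≡ (k i <ᵇ c)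
sorting-permutation {zero} k = Perm.id , λ ()
sorting-permutation {suc n} k with sorting-permutation (k ∘ Fin.suc)
... | π , hπ = insert Fin.zero p π , good
  where
  k′ = k ∘ Fin.suc
  q = cnt k′ (k Fin.zero)
  q≤n : q ≤ n
  q≤n = Subset.∣p∣≤n (below k′ (k Fin.zero))
  p : Fin (suc n)
  p = fromℕ< (s≤s q≤n)
  p≡q : toℕ p ≡ q
  p≡q = Fin.toℕ-fromℕ< (s≤s q≤n)
  p≤cnt : ∀ c → (k Fin.zero <ᵇ c) ≡ true → toℕ p ≤ cnt k′ c
  p≤cnt c e = subst (_≤ cnt k′ c) (sym p≡q) (cnt-mono k′ (k Fin.zero) c (<⇒≤ (<ᵇ≡⇒< (k Fin.zero) c e)))
  good : ∀ i c → (toℕ (insert Fin.zero p π ⟨$⟩ʳ i) <ᵇ cnt k c) ≡ (k i <ᵇ c)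
  good i c with k Fin.zero <ᵇ c in e
  good Fin.zero c | true = trans (<⇒<ᵇ≡ (s≤s (p≤cnt c e))) (sym e)
  good (Fin.suc i) c | true = trans (punchIn-<ᵇ-suc p (π ⟨$⟩ʳ i) _ (p≤cnt c e)) (hπ i c)
  good i c | false = go i
    where
    c≤k₀ : c ≤ k Fin.zero
    c≤k₀ = ≮⇒≥ λ h → case trans (sym (<⇒<ᵇ≡ h)) e of λ ()
    cnt≤p : cnt k′ c ≤ toℕ p
    cnt≤p = subst (cnt k′ c ≤_) (sym p≡q) (cnt-mono k′ c (k Fin.zero) c≤k₀)
    go : ∀ i → (toℕ (insert Fin.zero p π ⟨$⟩ʳ i) <ᵇ cnt k′ c) ≡ (k i <ᵇ c)
    go Fin.zero = trans (Bool.¬-not λ h → <⇒≱ (<ᵇ≡⇒< (toℕ p) _ h) cnt≤p) (sym e)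
    go (Fin.suc i) = trans (punchIn-<ᵇ p (π ⟨$⟩ʳ i) _ cnt≤p) (hπ i c)

_⊑_ : Subset n → Subset n → Set
S ⊑ S′ = ∀ i → S ! i ≡ true → S′ ! i ≡ true

Initial : Permutation′ n → Subset n → Set
Initial σ S = ∀ i → (toℕ (σ ⟨$⟩ʳ i) <ᵇ ∣ S ∣) ≡ S ! i

-- Each element is labelled by the first set of the chain containing it; sorting by this label
-- straightens all three sets at once.
chain-to-initial : (S₁ S₂ S₃ : Subset n) → S₁ ⊑ S₂ → S₂ ⊑ S₃ → ∃ λ σ → Initial σ S₁ × Initial σ S₂ × Initial σ S₃
chain-to-initial S₁ S₂ S₃ h₁₂ h₂₃
  with sorting-permutation (λ i → if S₁ ! i then 0 else if S₂ ! i then 1 else if S₃ ! i then 2 else 3)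
... | σ , h = σ , initial S₁ 1 lab₁ , initial S₂ 2 lab₂ , initial S₃ 3 lab₃
  where
  label = λ i → if S₁ ! i then 0 else if S₂ ! i then 1 else if S₃ ! i then 2 else 3
  initial : ∀ S c → (∀ i → (label i <ᵇ c) ≡ S ! i) → Initial σ S
  initial S c e i = trans (cong (toℕ (σ ⟨$⟩ʳ i) <ᵇ_) (cong ∣_∣ (sym (trans (tabulate-cong e) (tabulate∘lookup S)))))
    (trans (h i c) (e i))
  lab₁ : ∀ i → (label i <ᵇ 1) ≡ S₁ ! i
  lab₁ i with S₁ ! i | S₂ ! i | S₃ ! i
  ... | true | _ | _ = refl
  ... | false | true | _ = refl
  ... | false | false | true = refl
  ... | false | false | false = refl
  lab₂ : ∀ i → (label i <ᵇ 2) ≡ S₂ ! i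
  lab₂ i with S₁ ! i | S₂ ! i | S₃ ! i | h₁₂ i
  ... | true | _ | _ | g = sym (g refl)
  ... | false | true | _ | _ = refl
  ... | false | false | true | _ = refl
  ... | false | false | false | _ = refl
  lab₃ : ∀ i → (label i <ᵇ 3) ≡ S₃ ! i
  lab₃ i with S₁ ! i | S₂ ! i | S₃ ! i | h₁₂ i | h₂₃ i
  ... | true | _ | _ | g | g′ = sym (g′ (g refl))
  ... | false | true | _ | _ | g = sym (g refl)
  ... | false | false | true | _ | _ = refl
  ... | false | false | false | _ | _ = refl

module _ (σ : Permutation′ n) where

  image-! : ∀ A j → image σ A ! j ≡ A ! (σ ⟨$⟩ˡ j)
  image-! A j = lookup∘tabulate _ j

  image-at : ∀ A i → image σ A ! (σ ⟨$⟩ʳ i) ≡ A ! i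
  image-at A i = trans (image-! A _) (cong (A !_) (inverseˡ σ))

  σ-injective : ∀ {i j} → σ ⟨$⟩ʳ i ≡ σ ⟨$⟩ʳ j → i ≡ j
  σ-injective e = trans (sym (inverseˡ σ)) (trans (cong (σ ⟨$⟩ˡ_) e) (inverseˡ σ))

  ∣image∣ : ∀ A → ∣ image σ A ∣ ≡ ∣ A ∣
  ∣image∣ A = trans (∣∣≡length (image σ A) (Unique.map⁺ σ-injective (elems-unique A)) to from)
    (trans (length-map _ (elems A)) (length-elems A))
    where
    to : ∀ {j} → j ∈ map (σ ⟨$⟩ʳ_) (elems A) → image σ A ! j ≡ true
    to j∈ with ∈-map⁻ _ j∈
    ... | i , i∈ , refl = trans (image-at A i) (∈-elems⁻ A i∈)
    from : ∀ {j} → image σ A ! j ≡ true → j ∈ map (σ ⟨$⟩ʳ_) (elems A)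
    from {j} h = subst (_∈ _) (inverseʳ σ) (∈-map⁺ (σ ⟨$⟩ʳ_) (∈-elems⁺ A (trans (sym (image-! A j)) h)))

  initial-interval : ∀ {k} (S₁ S₃ : Subset n) → Initial σ S₁ → Initial σ S₃ → ∀ A →
    (∣ A ∣ ≡ k × S₁ ⊑ A × A ⊑ S₃) ⇔ Star (∣ S₃ ∣) k (∣ S₁ ∣) (image σ A)
  initial-interval {k} S₁ S₃ i₁ i₃ A = mk⇔
    (λ (c , lo , hi) → trans (∣image∣ A) c ,
      (λ j j∈ → <ᵇ≡⇒< (toℕ j) ∣ S₃ ∣ (trans (pos S₃ i₃ j) (hi _ (trans (sym (image-! A j)) ([]=⇒lookup j∈))))) ,
      (λ j j< → lookup⇒[]= j _ (trans (image-! A j) (lo _ (trans (sym (pos S₁ i₁ j)) (<⇒<ᵇ≡ j<))))))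
    (λ (c , hi , lo) → trans (sym (∣image∣ A)) c ,
      (λ i s₁ → trans (sym (image-at A i)) ([]=⇒lookup (lo (σ ⟨$⟩ʳ i) (<ᵇ≡⇒< (toℕ (σ ⟨$⟩ʳ i)) ∣ S₁ ∣ (trans (i₁ i) s₁))))) ,
      (λ i a → trans (sym (i₃ i)) (<⇒<ᵇ≡ (hi (σ ⟨$⟩ʳ i) (lookup⇒[]= _ _ (trans (image-at A i) a))))))
    where
    pos : ∀ S → Initial σ S → ∀ j → (toℕ j <ᵇ ∣ S ∣) ≡ S ! (σ ⟨$⟩ˡ j)
    pos S h j = trans (cong (λ x → toℕ x <ᵇ ∣ S ∣) (sym (inverseʳ σ))) (h (σ ⟨$⟩ˡ j))

  interInitSize-image : ∀ S → Initial σ S → ∀ A → interInitSize ∣ S ∣ (image σ A) ≡ ∣ A ∩ S ∣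
  interInitSize-image S h A = trans
    (cong ∣_∣ (subset-ext {S = image σ A ∩ tabulate (λ i → toℕ i <ᵇ ∣ S ∣)} {image σ (A ∩ S)} eq)) (∣image∣ (A ∩ S))
    where
    eq : ∀ j → (image σ A ∩ tabulate (λ i → toℕ i <ᵇ ∣ S ∣)) ! j ≡ image σ (A ∩ S) ! j
    eq j = begin
      (image σ A ∩ tabulate (λ i → toℕ i <ᵇ ∣ S ∣)) ! j
        ≡⟨ ∩-! (image σ A) _ j ⟩
      image σ A ! j ∧ tabulate (λ i → toℕ i <ᵇ ∣ S ∣) ! j
        ≡⟨ cong₂ _∧_ (image-! A j) (lookup∘tabulate _ j) ⟩
      A ! (σ ⟨$⟩ˡ j) ∧ (toℕ j <ᵇ ∣ S ∣)
        ≡⟨ cong (A ! (σ ⟨$⟩ˡ j) ∧_) (trans (cong (λ x → toℕ x <ᵇ ∣ S ∣) (sym (inverseʳ σ))) (h (σ ⟨$⟩ˡ j))) ⟩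
      A ! (σ ⟨$⟩ˡ j) ∧ S ! (σ ⟨$⟩ˡ j)
        ≡⟨ sym (∩-! A S (σ ⟨$⟩ˡ j)) ⟩
      (A ∩ S) ! (σ ⟨$⟩ˡ j)
        ≡⟨ sym (image-! (A ∩ S) j) ⟩
      image σ (A ∩ S) ! j ∎
      where open ≡-Reasoning

interval⇒Star : ∀ {k} {ℱ : Family n} (S₁ S₃ : Subset n) → S₁ ⊑ S₃ → (∀ A → A ∈ ℱ ⇔ (∣ A ∣ ≡ k × S₁ ⊑ A × A ⊑ S₃)) →
  IsoTo ℱ (Star (∣ S₃ ∣) k (∣ S₁ ∣))
interval⇒Star S₁ S₃ h char with chain-to-initial S₁ S₃ S₃ h (λ _ → id)
... | σ , i₁ , _ , i₃ = σ , λ A → initial-interval σ S₁ S₃ i₁ i₃ A ⇔-∘ char A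

-- The middle set of the chain, having t + 1 elements, is carried onto `[t + 1]`.
interval⇒Hilton : ∀ {t} {ℱ : Family n} (S₁ S₂ S₃ : Subset n) → ∣ S₂ ∣ ≡ t + 1 → S₁ ⊑ S₂ → S₂ ⊑ S₃ →
  (∀ A → A ∈ ℱ ⇔ ((∣ A ∣ ≡ t + 1 × S₁ ⊑ A × A ⊑ S₃) × t ≤ ∣ A ∩ S₂ ∣)) →
  IsoTo ℱ (Hilton (∣ S₃ ∣) t (∣ S₁ ∣))
interval⇒Hilton {t = t} S₁ S₂ S₃ ∣S₂∣ h₁₂ h₂₃ char with chain-to-initial S₁ S₂ S₃ h₁₂ h₂₃
... | σ , i₁ , i₂ , i₃ = σ , λ A → mk⇔
  (λ A∈ → let (p , q) = Equivalence.to (char A) A∈ in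
    Equivalence.to (initial-interval σ S₁ S₃ i₁ i₃ A) p , subst (t ≤_) (sym (inter A)) q)
  (λ (p , q) → Equivalence.from (char A) (Equivalence.from (initial-interval σ S₁ S₃ i₁ i₃ A) p , subst (t ≤_) (inter A) q))
  where
  inter : ∀ A → interInitSize (t + 1) (image σ A) ≡ ∣ A ∩ S₂ ∣
  inter A = subst (λ m → interInitSize m (image σ A) ≡ ∣ A ∩ S₂ ∣) ∣S₂∣ (interInitSize-image σ S₂ i₂ A)

-- From the graph back to families of sets

_∈ᶠ?_ : (i : Fin n) (W : List (Fin n)) → Dec (i ∈ W)
_∈ᶠ?_ = mem? Fin._≟_

module _ (β : Subset n) (W : List (Fin n)) where

  ⟦W⟧ : Subset n
  ⟦W⟧ = tabulate λ i → does (i ∈ᶠ? W)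

  ⟦W⟧⁺ : ∀ {i} → i ∈ W → ⟦W⟧ ! i ≡ true
  ⟦W⟧⁺ {i} h = trans (lookup∘tabulate _ i) (dec-true (i ∈ᶠ? W) h)

  ⟦W⟧⁻ : ∀ {i} → i ∉ W → ⟦W⟧ ! i ≡ false
  ⟦W⟧⁻ {i} h = trans (lookup∘tabulate _ i) (dec-false (i ∈ᶠ? W) h)

  ∈⟦W⟧ : ∀ {i} → ⟦W⟧ ! i ≡ true → i ∈ W
  ∈⟦W⟧ {i} h = decidable-stable (i ∈ᶠ? W) λ i∉ → case trans (sym h) (⟦W⟧⁻ i∉) of λ ()

  -- The least and the greatest set agreeing with β off `W`, provided `W` lies outside β for
  -- `b = false` and inside β for `b = true`.
  lo hi : Bool → Subset n
  lo false = β
  lo true  = β ∖ ⟦W⟧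
  hi false = β ∪ ⟦W⟧
  hi true  = β

  agree⇔interval : ∀ b → (∀ {i} → i ∈ W → β ! i ≡ b) → ∀ A → (∀ i → i ∉ W → A ! i ≡ β ! i) ⇔ (lo b ⊑ A × A ⊑ hi b)
  agree⇔interval false hW A = mk⇔
    (λ h → (λ i βi → trans (h i λ i∈ → case trans (sym βi) (hW i∈) of λ ()) βi) , up h)
    (λ (p , q) i i∉ → down p q i i∉)
    where
    up : (∀ i → i ∉ W → A ! i ≡ β ! i) → A ⊑ hi false
    up h i ai with i ∈ᶠ? W
    ... | yes i∈ = trans (∪-! β ⟦W⟧ i) (trans (cong (β ! i ∨_) (⟦W⟧⁺ i∈)) (Bool.∨-zeroʳ (β ! i)))
    ... | no i∉ = trans (∪-! β ⟦W⟧ i) (cong (_∨ ⟦W⟧ ! i) (trans (sym (h i i∉)) ai))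
    down : β ⊑ A → A ⊑ hi false → ∀ i → i ∉ W → A ! i ≡ β ! i
    down p q i i∉ with β ! i in βi | A ! i in ai
    ... | true | true = refl
    ... | false | false = refl
    ... | true | false = trans (sym ai) (p i βi)
    ... | false | true = trans (sym (q i ai)) (trans (∪-! β ⟦W⟧ i) (trans (cong (_∨ ⟦W⟧ ! i) βi) (⟦W⟧⁻ i∉)))
  agree⇔interval true hW A = mk⇔
    (λ h → (λ i l → let (βi , wi) = ∖⁻ β ⟦W⟧ l in trans (h i λ i∈ → case trans (sym (⟦W⟧⁺ i∈)) wi of λ ()) βi) , up h)
    (λ (p , q) i i∉ → down p q i i∉)
    where
    up : (∀ i → i ∉ W → A ! i ≡ β ! i) → A ⊑ β
    up h i ai with i ∈ᶠ? W
    ... | yes i∈ = hW i∈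
    ... | no i∉ = trans (sym (h i i∉)) ai
    down : lo true ⊑ A → A ⊑ β → ∀ i → i ∉ W → A ! i ≡ β ! i
    down p q i i∉ with β ! i in βi | A ! i in ai
    ... | true | true = refl
    ... | false | false = refl
    ... | true | false = trans (sym ai) (p i (∖⁺ β ⟦W⟧ βi (⟦W⟧⁻ i∉)))
    ... | false | true = trans (sym (q i ai)) βi

  -- Stated as sums: truncated subtraction would lose the inequalities t ≥ 2, t ≥ 3 and t ≥ s of the
  -- conclusion.
  IntervalSizes : ℕ → Bool → Set
  IntervalSizes t false = ∣ lo false ∣ + 2 ≡ t + 1 × ∣ hi false ∣ + 2 ≡ t + 1 + length W
  IntervalSizes t true  = ∣ lo true ∣ + length W ≡ t + 1 + 2 × ∣ hi true ∣ ≡ t + 1 + 2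

  interval-sizes : ∀ {t} b → BaseSize t b β → Unique W → (∀ {i} → i ∈ W → β ! i ≡ b) → IntervalSizes t b
  interval-sizes {t} false size uW hW = size , (begin
    ∣ β ∪ ⟦W⟧ ∣ + 2
      ≡⟨ cong (_+ 2) (sym (∣∖∣-⊆ (β ∪ ⟦W⟧) β λ i βi → trans (∪-! β ⟦W⟧ i) (cong (_∨ ⟦W⟧ ! i) βi))) ⟩
    ∣ β ∣ + ∣ (β ∪ ⟦W⟧) ∖ β ∣ + 2
      ≡⟨ cong (λ x → ∣ β ∣ + x + 2) (∣∣≡length ((β ∪ ⟦W⟧) ∖ β) uW
           (λ {i} i∈ → ∖⁺ (β ∪ ⟦W⟧) β (trans (∪-! β ⟦W⟧ i) (trans (cong (β ! i ∨_) (⟦W⟧⁺ i∈)) (Bool.∨-zeroʳ (β ! i)))) (hW i∈))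
           (λ {i} h → let (p , q) = ∖⁻ (β ∪ ⟦W⟧) β h in ∈⟦W⟧ (trans (sym (cong (_∨ ⟦W⟧ ! i) q)) (trans (sym (∪-! β ⟦W⟧ i)) p)))) ⟩
    ∣ β ∣ + length W + 2
      ≡⟨ +-assoc ∣ β ∣ (length W) 2 ⟩
    ∣ β ∣ + (length W + 2)
      ≡⟨ cong (∣ β ∣ +_) (+-comm (length W) 2) ⟩
    ∣ β ∣ + (2 + length W)
      ≡⟨ sym (+-assoc ∣ β ∣ 2 (length W)) ⟩
    ∣ β ∣ + 2 + length W
      ≡⟨ cong (_+ length W) size ⟩
    t + 1 + length W ∎)
    where open ≡-Reasoning
  interval-sizes {t} true size uW hW = (begin
    ∣ β ∖ ⟦W⟧ ∣ + length W     ≡⟨ +-comm ∣ β ∖ ⟦W⟧ ∣ (length W) ⟩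
    length W + ∣ β ∖ ⟦W⟧ ∣     ≡⟨ cong (_+ ∣ β ∖ ⟦W⟧ ∣) (sym (∣∣≡length ⟦W⟧ uW ⟦W⟧⁺ ∈⟦W⟧)) ⟩
    ∣ ⟦W⟧ ∣ + ∣ β ∖ ⟦W⟧ ∣      ≡⟨ ∣∖∣-⊆ β ⟦W⟧ (λ i wi → hW (∈⟦W⟧ wi)) ⟩
    ∣ β ∣                      ≡⟨ size ⟩
    t + 1 + 2                  ∎) , size
    where open ≡-Reasoning

module Structure {n t s : ℕ} (ℱ : Family n) (uniq : Unique ℱ) (unif : ∀ {A} → A ∈ ℱ → ∣ A ∣ ≡ t + 1)
  (almost : AlmostIntersecting s t ℱ) (large : 3 + (s + s) ≤ length ℱ) (larger : s ≡ 1 ⊎ s ≡ 3 → 4 + (s + s) ≤ length ℱ)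
  (1≤s : 1 ≤ s) (b : Bool) (β : Subset n) (size : BaseSize t b β) (within : ∀ {N} → N ∈ ℱ → Within b β N) where

  open Graph ℱ uniq unif almost large larger 1≤s b β size within
  open E

  module _ (W : List (Fin n)) (hW : ∀ {w} → w ∈ W → β ! w ≡ b) where

    toggles-within : ∀ {A} → ∣ A ∣ ≡ t + 1 → (∀ i → i ∉ W → A ! i ≡ β ! i) →
      ∃₂ λ u v → u ≢ v × u ∈ W × v ∈ W × A ≡ T β u v
    toggles-within {A} ∣A∣ h with two-toggles b β A size ∣A∣ (λ i βi → trans (h i λ i∈ → not≢ b (trans (sym βi) (hW i∈))) βi)
    ... | u , v , u≢v , _ , _ , refl = u , v , u≢v , changed (T-left β u v) , changed (T-right β u v) , refl
      where
      changed : ∀ {i} → T β u v ! i ≡ not (β ! i) → i ∈ W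
      changed {i} e = decidable-stable (i ∈ᶠ? W) λ i∉ → not≢ (β ! i) (trans (sym e) (h i i∉))

    agree : (∀ {u v} → E u v → u ∈ W) → ∀ {A} → A ∈ ℱ → ∀ i → i ∉ W → A ! i ≡ β ! i
    agree covered A∈ i i∉ with edge-of A∈
    ... | u , v , e , refl = T-off β (λ { refl → i∉ (covered e) }) (λ { refl → i∉ (covered (E-sym e)) })

  -- A set of size t + 1 in the interval toggles exactly two elements of `W`, and any two are
  -- adjacent.
  complete⇒Star : (W : List (Fin n)) → AllPairs E W → (∀ {w} → w ∈ W → β ! w ≡ b) → (∀ {u v} → E u v → u ∈ W) →
    IsoTo ℱ (Star (∣ hi β W b ∣) (t + 1) (∣ lo β W b ∣))
  complete⇒Star W all hW covered = interval⇒Star (lo β W b) (hi β W b) (lo⊑hi b refl) λ A → mk⇔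
    (λ A∈ → unif A∈ , Equivalence.to (agree⇔interval β W b hW A) (agree W hW covered A∈))
    (λ (∣A∣ , h) → from {A} ∣A∣ (Equivalence.from (agree⇔interval β W b hW A) h))
    where
    lo⊑hi : ∀ x → b ≡ x → lo β W b ⊑ hi β W b
    lo⊑hi x refl = λ i l → let (p , q) = Equivalence.to (agree⇔interval β W b hW β) (λ _ _ → refl) in q i (p i l)
    from : ∀ {A} → ∣ A ∣ ≡ t + 1 → (∀ i → i ∉ W → A ! i ≡ β ! i) → A ∈ ℱ
    from {A} ∣A∣ h with toggles-within W hW {A} ∣A∣ h
    ... | u , v , u≢v , u∈ , v∈ , refl = mem (AllPairs-lookup E-sym all u∈ v∈ u≢v)

  -- The middle set of the chain is the member `T β a d`: sharing at least t elements with it means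
  -- not conflicting with it, that is, using a or d as an end.
  join⇒Hilton : (a d : Fin n) (V : List (Fin n)) → E a d → (∀ {v} → v ∈ V → E a v × E d v) →
    (∀ {u v} → E u v → u ∈ a ∷ d ∷ V) → (∀ {u v} → E u v → (u ≡ a ⊎ u ≡ d) ⊎ (v ≡ a ⊎ v ≡ d)) →
    (∀ {w} → w ∈ a ∷ d ∷ V → β ! w ≡ b) × IsoTo ℱ (Hilton (∣ hi β (a ∷ d ∷ V) b ∣) t (∣ lo β (a ∷ d ∷ V) b ∣))
  join⇒Hilton a d V a-d spokes covered touch = hW , interval⇒Hilton (lo β W b) (T β a d) (hi β W b) (unif (mem a-d))
    (proj₁ (between (mem a-d))) (proj₂ (between (mem a-d))) λ A → mk⇔
      (λ A∈ → (unif A∈ , between A∈) , near A∈)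
      (λ ((∣A∣ , h) , le) → from {A} ∣A∣ (Equivalence.from (agree⇔interval β W b hW A) h) le)
    where
    W = a ∷ d ∷ V
    hW : ∀ {w} → w ∈ W → β ! w ≡ b
    hW (here refl) = βˡ a-d
    hW (there (here refl)) = βʳ a-d
    hW (there (there v∈)) = βʳ (proj₁ (spokes v∈))
    between : ∀ {A} → A ∈ ℱ → lo β W b ⊑ A × A ⊑ hi β W b
    between {A} A∈ = Equivalence.to (agree⇔interval β W b hW A) (agree W hW covered A∈)
    row : ∀ {u v} → u ≡ a ⊎ u ≡ d → E u v → ¬ Conf t (T β u v) (T β a d)
    row (inj₁ refl) e = shared⇒¬conf b β (unif (mem e)) (ends≢ e) (ends≢ a-d) (βˡ e) (βʳ e) (βʳ a-d)
    row {v = v} (inj₂ refl) e c = shared⇒¬conf b β (unif (mem e)) (ends≢ e) (ends≢ a-d ∘ sym) (βˡ e) (βʳ e) (βˡ a-d)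
      (subst (Conf t (T β d v)) (T-sym β a d) c)
    near : ∀ {A} → A ∈ ℱ → t ≤ ∣ A ∩ T β a d ∣
    near A∈ with edge-of A∈
    ... | u , v , e , refl with touch e
    ...   | inj₁ p = ≮⇒≥ (row p e)
    ...   | inj₂ p = ≮⇒≥ λ c → row p (E-sym e) (subst (λ X → Conf t X (T β a d)) (T-sym β u v) c)
    spoke : ∀ {u v} → u ≡ a ⊎ u ≡ d → v ∈ W → u ≢ v → E u v
    spoke (inj₁ refl) (here refl) ne = contradiction refl ne
    spoke (inj₁ refl) (there (here refl)) ne = a-d
    spoke (inj₁ refl) (there (there v∈)) ne = proj₁ (spokes v∈)
    spoke (inj₂ refl) (here refl) ne = E-sym a-d
    spoke (inj₂ refl) (there (here refl)) ne = contradiction refl ne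
    spoke (inj₂ refl) (there (there v∈)) ne = proj₂ (spokes v∈)
    from : ∀ {A} → ∣ A ∣ ≡ t + 1 → (∀ i → i ∉ W → A ! i ≡ β ! i) → t ≤ ∣ A ∩ T β a d ∣ → A ∈ ℱ
    from {A} ∣A∣ h le with toggles-within W hW {A} ∣A∣ h
    -- The repeated arguments make `position` decide membership in {a, d}.
    ... | u , v , u≢v , u∈ , v∈ , refl with position a d a d u | position a d a d v
    ...   | is-a p | _ = mem (spoke (inj₁ p) v∈ u≢v)
    ...   | is-b p | _ = mem (spoke (inj₂ p) v∈ u≢v)
    ...   | is-c p | _ = mem (spoke (inj₁ p) v∈ u≢v)
    ...   | is-d p | _ = mem (spoke (inj₂ p) v∈ u≢v)
    ...   | out _ | is-a p = mem (E-sym (spoke (inj₁ p) u∈ (u≢v ∘ sym)))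
    ...   | out _ | is-b p = mem (E-sym (spoke (inj₂ p) u∈ (u≢v ∘ sym)))
    ...   | out _ | is-c p = mem (E-sym (spoke (inj₁ p) u∈ (u≢v ∘ sym)))
    ...   | out _ | is-d p = mem (E-sym (spoke (inj₂ p) u∈ (u≢v ∘ sym)))
    ...   | out (u≢a , u≢d , _) | out (v≢a , v≢d , _) =
      contradiction (disjoint⇒conf b β ∣A∣ u≢v (ends≢ a-d) (hW u∈) (hW v∈) (βˡ a-d) (βʳ a-d) (u≢a , u≢d , v≢a , v≢d)) (≤⇒≯ le)

-- Lower bounds for the maximum

-- The binomial coefficient `k` choose 2.
tri : ℕ → ℕ
tri zero    = 0
tri (suc k) = k + tri k

length-pairs : (xs : List X) → length (pairs xs) ≡ tri (length xs)
length-pairs [] = refl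
length-pairs (x ∷ xs) = trans (length-++ (map (x ,_) xs)) (cong₂ _+_ (length-map (x ,_) xs) (length-pairs xs))

tri-mono : ∀ {j k} → j ≤ k → tri j ≤ tri k
tri-mono z≤n = z≤n
tri-mono (s≤s h) = +-mono-≤ h (tri-mono h)

∣initial∣ : ∀ {n} m → m ≤ n → ∣ tabulate {n = n} (λ i → toℕ i <ᵇ m) ∣ ≡ m
∣initial∣ {zero} zero _ = refl
∣initial∣ {suc n} zero _ = ∣initial∣ {n} zero z≤n
∣initial∣ {suc n} (suc m) (s≤s h) = cong suc (∣initial∣ {n} m h)

avoiding : (β : Subset n) (k : ℕ) → ∣ β ∣ + k ≤ n →
  ∃ λ W → Unique W × length W ≡ k × (∀ {w} → w ∈ W → β ! w ≡ false)
avoiding {n} β k h = take k (elems (∁ β)) , Unique.take⁺ k (elems-unique (∁ β)) ,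
  trans (length-take k (elems (∁ β))) (m≤n⇒m⊓n≡m (begin
    k                     ≤⟨ m+n≤o⇒n≤o∸m k h ⟩
    n ∸ ∣ β ∣             ≡⟨ sym (Subset.∣∁p∣≡n∸∣p∣ β) ⟩
    ∣ ∁ β ∣               ≡⟨ sym (length-elems (∁ β)) ⟩
    length (elems (∁ β))  ∎)) ,
  λ {w} w∈ → Bool.¬-not λ βw → case trans (sym (∈-elems⁻ (∁ β) (take⊆ k w∈))) (trans (lookup-map w not β) (cong not βw)) of λ ()
  where
  open ≤-Reasoning
  m+n≤o⇒n≤o∸m : ∀ k → ∣ β ∣ + k ≤ n → k ≤ n ∸ ∣ β ∣
  m+n≤o⇒n≤o∸m k h = m+n≤o⇒m≤o∸n k (subst (_≤ n) (+-comm ∣ β ∣ k) h)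
  take⊆ : ∀ k {xs : List (Fin n)} {w} → w ∈ take k xs → w ∈ xs
  take⊆ (suc k) {_ ∷ _} (here p) = here p
  take⊆ (suc k) {_ ∷ _} (there p) = there (take⊆ k p)

-- The conditions on a competitor for the maximum size.
Extremal : ℕ → ℕ → Family n → Set
Extremal s t 𝒢 = IsUniform (t + 1) 𝒢 × AlmostIntersecting s t 𝒢 × ¬ Intersecting t 𝒢

module _ {n t : ℕ} (β : Subset n) (size : BaseSize t false β) where

  ∣T∣ : ∀ {u v} → u ≢ v → β ! u ≡ false → β ! v ≡ false → ∣ T β u v ∣ ≡ t + 1
  ∣T∣ {u} {v} u≢v βu βv = trans (sym (∣∖∣-⊆ (T β u v) β β⊆)) (trans (cong (∣ β ∣ +_) two) size)
    where
    β⊆ : ∀ i → β ! i ≡ true → T β u v ! i ≡ true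
    β⊆ i βi = trans (T-off β (≢-by β βi βu) (≢-by β βi βv)) βi
    two : ∣ T β u v ∖ β ∣ ≡ 2
    two = ∣∣≡length (T β u v ∖ β) (unique₂ u≢v) (λ
      { (here refl) → ∖⁺ (T β u v) β (T-in false β βu) βu
      ; (there (here refl)) → ∖⁺ (T β u v) β (T-in′ false β βv) βv })
      λ {i} h → let (p , q) = ∖⁻ (T β u v) β h in only i p q
      where
      only : ∀ i → T β u v ! i ≡ true → β ! i ≡ false → i ∈ u ∷ v ∷ []
      only i p q with i Fin.≟ u | i Fin.≟ v
      ... | yes e | _ = here e
      ... | no _ | yes e = there (here e)
      ... | no e | no f = case trans (sym p) (trans (T-off β e f) q) of λ ()

  few-conflicts : ∀ {s} A {𝒢 L : List (Subset n)} → Unique 𝒢 → (∀ {N} → N ∈ 𝒢 → Conf t A N → N ∈ L) → length L ≤ s →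
    length (filter (conf? t A) 𝒢) ≤ s
  few-conflicts A u h l = ≤-trans (unique⊆⇒length≤ (Unique.filter⁺ (conf? t A) u)
    λ N∈ → let (p , q) = ∈-filter⁻ (conf? t A) N∈ in h p q) l

  module _ (W : List (Fin n)) (uW : Unique W) (hW : ∀ {w} → w ∈ W → β ! w ≡ false) where

    complete-family : Family n
    complete-family = map (uncurriedT β) (pairs W)

    length-complete-family : length complete-family ≡ tri (length W)
    length-complete-family = trans (length-map (uncurriedT β) (pairs W)) (length-pairs W)

    -- A conflict with uv comes from an edge on the remaining vertices; four vertices suffice for
    -- two disjoint edges.
    complete-family-extremal : 4 ≤ length W → Extremal (tri (length W ∸ 2)) t complete-family
    complete-family-extremal 4≤ = (unique , All.tabulate uniform) , almost , conflict W refl uW 4≤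
      where
      unique = T-pairs-unique β uW
      uniform : ∀ {A} → A ∈ complete-family → ∣ A ∣ ≡ t + 1
      uniform A∈ with ∈-map⁻ (uncurriedT β) A∈
      ... | _ , p , refl with pairs⇒AllPairs uW p
      ...   | u≢v , u∈ , v∈ = ∣T∣ u≢v (hW u∈) (hW v∈)
      almost : AlmostIntersecting (tri (length W ∸ 2)) t complete-family
      almost A A∈ with ∈-map⁻ (uncurriedT β) A∈
      ... | (u , v) , p , refl with pairs⇒AllPairs uW p
      ...   | u≢v , u∈ , v∈ = few-conflicts (T β u v) unique rest short
        where
        P? = λ w → ¬? (w Fin.≟ u) ×-dec ¬? (w Fin.≟ v)
        W′ = filter P? W
        ∈W′ : ∀ {w} → w ∈ W → u ≢ w → v ≢ w → w ∈ W′
        ∈W′ w∈ p q = ∈-filter⁺ P? w∈ (p ∘ sym , q ∘ sym)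
        rest : ∀ {N} → N ∈ complete-family → Conf t (T β u v) N → N ∈ map (uncurriedT β) (pairs W′)
        rest N∈ c with ∈-map⁻ (uncurriedT β) N∈
        ... | (w , z) , q , refl with pairs⇒AllPairs uW q
        ...   | w≢z , w∈ , z∈ with conf⇒disjoint false β (∣T∣ u≢v (hW u∈) (hW v∈)) u≢v w≢z (hW u∈) (hW v∈) (hW w∈) (hW z∈) c
        ...     | u≢w , u≢z , v≢w , v≢z with ∈-pairs (∈W′ w∈ u≢w v≢w) (∈W′ z∈ u≢z v≢z) w≢z
        ...       | inj₁ r = ∈-map⁺ (uncurriedT β) r
        ...       | inj₂ r = subst (_∈ map (uncurriedT β) (pairs W′)) (T-sym β z w) (∈-map⁺ (uncurriedT β) r)
        short′ : 2 + length W′ ≤ length W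
        short′ = unique⊆⇒length≤ ((u≢v ∷ All.tabulate (λ w∈ → proj₁ (proj₂ (∈-filter⁻ P? {xs = W} w∈)) ∘ sym)) ∷
          All.tabulate (λ w∈ → proj₂ (proj₂ (∈-filter⁻ P? {xs = W} w∈)) ∘ sym) ∷ Unique.filter⁺ P? uW)
          λ { (here refl) → u∈ ; (there (here refl)) → v∈ ; (there (there w∈)) → proj₁ (∈-filter⁻ P? w∈) }
        short : length (map (uncurriedT β) (pairs W′)) ≤ tri (length W ∸ 2)
        short = ≤-trans (≤-reflexive (trans (length-map (uncurriedT β) (pairs W′)) (length-pairs W′))) (tri-mono (∸-monoˡ-≤ 2 short′))
      conflict : ∀ W′ → W′ ≡ W → Unique W′ → 4 ≤ length W′ → ¬ Intersecting t complete-family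
      conflict (x ∷ y ∷ z ∷ w ∷ V) refl ((x≢y ∷ x≢z ∷ x≢w ∷ _) ∷ (y≢z ∷ y≢w ∷ _) ∷ (z≢w ∷ _) ∷ _) _ int =
        <⇒≱ (disjoint⇒conf false β (∣T∣ x≢y βx βy) x≢y z≢w βx βy βz βw (x≢z , x≢w , y≢z , y≢w))
          (int _ _ (member (here refl) (there (here refl)) x≢y)
            (member (there (there (here refl))) (there (there (there (here refl)))) z≢w))
        where
        βx = hW (here refl)
        βy = hW (there (here refl))
        βz = hW (there (there (here refl)))
        βw = hW (there (there (there (here refl))))
        member : ∀ {u v} → u ∈ W → v ∈ W → u ≢ v → T β u v ∈ complete-family
        member {u} {v} p q ne with ∈-pairs p q ne
        ... | inj₁ r = ∈-map⁺ (uncurriedT β) r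
        ... | inj₂ r = subst (_∈ complete-family) (T-sym β v u) (∈-map⁺ (uncurriedT β) r)
      conflict [] refl _ () _
      conflict (_ ∷ []) refl _ (s≤s ()) _
      conflict (_ ∷ _ ∷ []) refl _ (s≤s (s≤s ())) _
      conflict (_ ∷ _ ∷ _ ∷ []) refl _ (s≤s (s≤s (s≤s ()))) _

  module _ (a d : Fin n) (V : List (Fin n)) (uW : Unique (a ∷ d ∷ V)) (hW : ∀ {w} → w ∈ a ∷ d ∷ V → β ! w ≡ false) where

    join-family : Family n
    join-family = map (T β a) (d ∷ V) ++ map (T β d) V

    length-join-family : length join-family ≡ suc (length V) + length V
    length-join-family = trans (length-++ (map (T β a) (d ∷ V))) (cong₂ _+_ (length-map (T β a) (d ∷ V)) (length-map (T β d) V))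

    private
      a∉ : All (a ≢_) (d ∷ V)
      a∉ = AllPairs.head uW
      d∉ : All (d ≢_) V
      d∉ = AllPairs.head (AllPairs.tail uW)
      uV : Unique V
      uV = AllPairs.tail (AllPairs.tail uW)
      a≢d = All.head a∉
      βa = hW (here refl)
      βd = hW (there (here refl))
      βV : ∀ {v} → v ∈ V → β ! v ≡ false
      βV v∈ = hW (there (there v∈))

      data Member (A : Subset n) : Set where
        hub : A ≡ T β a d → Member A
        a-spoke : ∀ {v} → v ∈ V → A ≡ T β a v → Member A
        d-spoke : ∀ {v} → v ∈ V → A ≡ T β d v → Member A

      member : ∀ {A} → A ∈ join-family → Member A
      member A∈ with ∈-++⁻ (map (T β a) (d ∷ V)) A∈
      ... | inj₁ p with ∈-map⁻ (T β a) p
      ...   | v , here refl , eq = hub eq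
      ...   | v , there v∈ , eq = a-spoke v∈ eq
      member A∈ | inj₂ p with ∈-map⁻ (T β d) p
      ...   | v , v∈ , eq = d-spoke v∈ eq

      others : Fin n → List (Fin n)
      others v = filter (λ w → ¬? (w Fin.≟ v)) V

      length-others : ∀ {s v} → length V ≡ suc s → v ∈ V → length (others v) ≤ s
      length-others {s} {v} eq v∈ = +-cancelˡ-≤ 1 _ _ (subst (suc (length (others v)) ≤_) eq
        (unique⊆⇒length≤ (All.tabulate (λ w∈ → proj₂ (∈-filter⁻ (λ w → ¬? (w Fin.≟ v)) {xs = V} w∈) ∘ sym) ∷ Unique.filter⁺ _ uV)
          λ { (here refl) → v∈ ; (there w∈) → proj₁ (∈-filter⁻ (λ w → ¬? (w Fin.≟ v)) w∈) }))

      disj : ∀ {u v w z} → u ∈ a ∷ d ∷ V → v ∈ a ∷ d ∷ V → w ∈ a ∷ d ∷ V → z ∈ a ∷ d ∷ V → u ≢ v → w ≢ z →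
        Conf t (T β u v) (T β w z) → Disjoint u v w z
      disj u∈ v∈ w∈ z∈ u≢v w≢z = conf⇒disjoint false β (∣T∣ u≢v (hW u∈) (hW v∈)) u≢v w≢z (hW u∈) (hW v∈) (hW w∈) (hW z∈)

      a∈ : a ∈ a ∷ d ∷ V
      a∈ = here refl
      d∈ : d ∈ a ∷ d ∷ V
      d∈ = there (here refl)
      a≢ : ∀ {v} → v ∈ V → a ≢ v
      a≢ v∈ = All.lookup a∉ (there v∈)
      d≢ : ∀ {v} → v ∈ V → d ≢ v
      d≢ = All.lookup d∉

    -- The central edge meets every other edge. An edge from a to v can conflict only with the edges
    -- from d to the s other vertices of `V`, and symmetrically.
    join-family-extremal : ∀ {s} → 1 ≤ s → length V ≡ suc s → Extremal s t join-family
    join-family-extremal {s} 1≤s lenV = (unique , All.tabulate uniform) , almost , conflict V refl lenV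
      where
      unique : Unique join-family
      unique = Unique.++⁺ (T-row-unique β a a∉ (AllPairs.tail uW)) (T-row-unique β d d∉ uV) λ (p , q) → apart p q
        where
        apart : ∀ {A} → A ∈ map (T β a) (d ∷ V) → A ∈ map (T β d) V → ⊥
        apart p q with ∈-map⁻ (T β a) p | ∈-map⁻ (T β d) q
        ... | x , _ , refl | v , v∈ , eq = T-distinct β a≢d (a≢ v∈) eq
      uniform : ∀ {A} → A ∈ join-family → ∣ A ∣ ≡ t + 1
      uniform A∈ with member A∈
      ... | hub refl = ∣T∣ a≢d βa βd
      ... | a-spoke v∈ refl = ∣T∣ (a≢ v∈) βa (βV v∈)
      ... | d-spoke v∈ refl = ∣T∣ (d≢ v∈) βd (βV v∈)
      almost : AlmostIntersecting s t join-family
      almost A A∈ with member A∈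
      ... | hub refl = few-conflicts (T β a d) {L = []} unique none z≤n
        where
        none : ∀ {N} → N ∈ join-family → Conf t (T β a d) N → N ∈ []
        none N∈ c with member N∈
        ... | hub refl = contradiction refl (proj₁ (disj a∈ d∈ a∈ d∈ a≢d a≢d c))
        ... | a-spoke v∈ refl = contradiction refl (proj₁ (disj a∈ d∈ a∈ (there (there v∈)) a≢d (a≢ v∈) c))
        ... | d-spoke v∈ refl = contradiction refl (proj₁ (proj₂ (proj₂ (disj a∈ d∈ d∈ (there (there v∈)) a≢d (d≢ v∈) c))))
      ... | a-spoke {v} v∈ refl = few-conflicts (T β a v) unique rest
        (≤-trans (≤-reflexive (length-map (T β d) (others v))) (length-others lenV v∈))
        where
        rest : ∀ {N} → N ∈ join-family → Conf t (T β a v) N → N ∈ map (T β d) (others v)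
        rest N∈ c with member N∈
        ... | hub refl = contradiction refl (proj₁ (disj a∈ (there (there v∈)) a∈ d∈ (a≢ v∈) a≢d c))
        ... | a-spoke w∈ refl = contradiction refl (proj₁ (disj a∈ (there (there v∈)) a∈ (there (there w∈)) (a≢ v∈) (a≢ w∈) c))
        ... | d-spoke w∈ refl = ∈-map⁺ (T β d) (∈-filter⁺ _ w∈
          (proj₂ (proj₂ (proj₂ (disj a∈ (there (there v∈)) d∈ (there (there w∈)) (a≢ v∈) (d≢ w∈) c))) ∘ sym))
      ... | d-spoke {v} v∈ refl = few-conflicts (T β d v) unique rest
        (≤-trans (≤-reflexive (length-map (T β a) (others v))) (length-others lenV v∈))
        where
        rest : ∀ {N} → N ∈ join-family → Conf t (T β d v) N → N ∈ map (T β a) (others v)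
        rest N∈ c with member N∈
        ... | hub refl = contradiction refl (proj₁ (proj₂ (disj d∈ (there (there v∈)) a∈ d∈ (d≢ v∈) a≢d c)))
        ... | a-spoke w∈ refl = ∈-map⁺ (T β a) (∈-filter⁺ _ w∈
          (proj₂ (proj₂ (proj₂ (disj d∈ (there (there v∈)) a∈ (there (there w∈)) (d≢ v∈) (a≢ w∈) c))) ∘ sym))
        ... | d-spoke w∈ refl = contradiction refl (proj₁ (disj d∈ (there (there v∈)) d∈ (there (there w∈)) (d≢ v∈) (d≢ w∈) c))
      conflict : ∀ V′ → V′ ≡ V → length V′ ≡ suc s → ¬ Intersecting t join-family
      conflict [] _ ()
      conflict (_ ∷ []) _ e = contradiction (subst (1 ≤_) (suc-injective (sym e)) 1≤s) λ ()
      conflict (x ∷ y ∷ _) refl _ int = <⇒≱ (disjoint⇒conf false β (∣T∣ (a≢ x∈) βa (βV x∈)) (a≢ x∈) (d≢ y∈) βa (βV x∈) βd (βV y∈)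
        (a≢d , a≢ y∈ , d≢ x∈ ∘ sym , All.head (AllPairs.head uV)))
        (int (T β a x) (T β d y) (∈-++⁺ˡ (∈-map⁺ (T β a) (there x∈))) (∈-++⁺ʳ (map (T β a) (d ∷ V)) (∈-map⁺ (T β d) y∈)))
        where
        x∈ : x ∈ V
        x∈ = here refl
        y∈ : y ∈ V
        y∈ = there (here refl)

-- Matching the graphs with the seven families

+2⇒+1 : ∀ x y → x + 2 ≡ y + 1 → x + 1 ≡ y
+2⇒+1 x y h = +-cancelʳ-≡ 1 _ _ (trans (+-assoc x 1 1) h)

module _ {A B : Subset n} (Q : Quad A B) where
  open Quad Q

  ∣A∖B∣ : ∣ A ∖ B ∣ ≡ 2
  ∣A∖B∣ = ∣∣≡length (A ∖ B) (unique₂ a≢b) (λ { (here refl) → ∖⁺ A B Aa Ba ; (there (here refl)) → ∖⁺ A B Ab Bb })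
    λ {i} h → let (ai , bi) = ∖⁻ A B h in only i ai bi
    where
    only : ∀ i → A ! i ≡ true → B ! i ≡ false → i ∈ a ∷ b ∷ []
    only i ai bi with i Fin.≟ a | i Fin.≟ b
    ... | yes e | _ = here e
    ... | no _ | yes e = there (here e)
    ... | no e | no f = case trans (sym ai) (trans (rest i e f (≢-by A ai Ac) (≢-by A ai Ad)) bi) of λ ()

  ∣A∪B∣ : ∣ A ∪ B ∣ ≡ ∣ A ∣ + 2
  ∣A∪B∣ = trans (sym (∣∖∣-⊆ (A ∪ B) A λ i ai → ∪⁺ (inj₁ ai))) (cong (∣ A ∣ +_) two)
    where
    ∪⁺ : ∀ {i} → A ! i ≡ true ⊎ B ! i ≡ true → (A ∪ B) ! i ≡ true
    ∪⁺ {i} (inj₁ e) rewrite ∪-! A B i | e = refl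
    ∪⁺ {i} (inj₂ e) rewrite ∪-! A B i | e = Bool.∨-zeroʳ (A ! i)
    only : ∀ i → A ! i ≡ false → B ! i ≡ true → i ∈ c ∷ d ∷ []
    only i ai bi with i Fin.≟ c | i Fin.≟ d
    ... | yes e | _ = here e
    ... | no _ | yes e = there (here e)
    ... | no e | no f = case trans (sym bi) (trans (sym (rest i (≢-by B bi Ba) (≢-by B bi Bb) e f)) ai) of λ ()
    two : ∣ (A ∪ B) ∖ A ∣ ≡ 2
    two = ∣∣≡length ((A ∪ B) ∖ A) (unique₂ c≢d) (λ
      { (here refl) → ∖⁺ (A ∪ B) A (∪⁺ (inj₂ Bc)) Ac ; (there (here refl)) → ∖⁺ (A ∪ B) A (∪⁺ (inj₂ Bd)) Ad })
      λ {i} h → let (ui , ai) = ∖⁻ (A ∪ B) A h in only i ai (trans (sym (cong (_∨ B ! i) ai)) (trans (sym (∪-! A B i)) ui))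

x+k≡y⇒x≡y∸k : ∀ x y k → x + k ≡ y → x ≡ y ∸ k
x+k≡y⇒x≡y∸k x y k h = trans (sym (m+n∸n≡m x k)) (cong (_∸ k) h)

-- Gives the size of the upper end of the interval when `W` has k + 1 elements; `top-lo` gives that
-- of the lower end when `W` has j + 3.
star-hi : ∀ x y k → x + 2 ≡ y + 1 + suc k → x ≡ y + k
star-hi x y k h = +-cancelʳ-≡ 2 _ _ (trans h (trans (+-assoc y 1 (suc k)) (trans (cong (y +_) (+-comm 2 k)) (sym (+-assoc y k 2)))))

top-lo : ∀ x y j → x + (j + 3) ≡ y + 1 + 2 → x + j ≡ y
top-lo x y j h = +-cancelʳ-≡ 3 _ _ (trans (+-assoc x j 3) (trans h (+-assoc y 1 2)))

module Final {n t s : ℕ} (1≤t : 1 ≤ t) (1≤s : 1 ≤ s) (n-large : t + s + 2 ≤ n) (ℱ : Family n) (U : IsUniform (t + 1) ℱ)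
  (almost : AlmostIntersecting s t ℱ) (¬int : ¬ Intersecting t ℱ)
  (maximum : (𝒢 : Family n) → Extremal s t 𝒢 → length 𝒢 ≤ length ℱ) where

  t∸1+1 : t ∸ 1 + 1 ≡ t
  t∸1+1 = m∸n+n≡m 1≤t

  -- The base takes t - 1 elements and the join s + 3 vertices (two central, s + 1 isolated), which
  -- together make t + s + 2.
  room : ∀ {k} → k ≤ s + 3 → (t ∸ 1) + k ≤ n
  room {k} h = begin
    t ∸ 1 + k          ≤⟨ +-monoʳ-≤ (t ∸ 1) h ⟩
    t ∸ 1 + (s + 3)    ≡⟨ cong (t ∸ 1 +_) (trans (+-comm s 3) (cong (1 +_) (+-comm 2 s))) ⟩
    t ∸ 1 + (1 + (s + 2)) ≡⟨ sym (+-assoc (t ∸ 1) 1 (s + 2)) ⟩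
    t ∸ 1 + 1 + (s + 2) ≡⟨ cong (_+ (s + 2)) t∸1+1 ⟩
    t + (s + 2)        ≡⟨ sym (+-assoc t s 2) ⟩
    t + s + 2          ≤⟨ n-large ⟩
    n                  ∎
    where open ≤-Reasoning

  β₀ : Subset n
  β₀ = tabulate λ i → toℕ i <ᵇ (t ∸ 1)

  ∣β₀∣ : ∣ β₀ ∣ ≡ t ∸ 1
  ∣β₀∣ = ∣initial∣ (t ∸ 1) (≤-trans (m≤m+n (t ∸ 1) 0) (room z≤n))

  size₀ : BaseSize t false β₀
  size₀ = trans (cong (_+ 2) ∣β₀∣) (trans (sym (+-assoc (t ∸ 1) 1 1)) (cong (_+ 1) t∸1+1))

  vertices : ∀ k → k ≤ s + 3 → ∃ λ W → Unique W × length W ≡ k × (∀ {w} → w ∈ W → β₀ ! w ≡ false)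
  vertices k h = avoiding β₀ k (subst (λ x → x + k ≤ n) (sym ∣β₀∣) (room h))

  large : 3 + (s + s) ≤ length ℱ
  large with vertices (s + 3) ≤-refl
  ... | [] , _ , e , _ = contradiction (trans e (+-comm s 3)) λ ()
  ... | _ ∷ [] , _ , e , _ = contradiction (trans e (+-comm s 3)) λ ()
  ... | a ∷ d ∷ V , uW , e , hW = subst (_≤ length ℱ) (trans (length-join-family β₀ size₀ a d V uW hW)
          (trans (cong (λ x → suc x + x) lenV) (cong (2 +_) (+-suc s s))))
          (maximum _ (join-family-extremal β₀ size₀ a d V uW hW 1≤s lenV))
    where
    lenV : length V ≡ suc s
    lenV = suc-injective (suc-injective (trans e (+-comm s 3)))

  -- K₄ has 6 = 2·1 + 4 edges and K₅ has 10 = 2·3 + 4.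
  larger : s ≡ 1 ⊎ s ≡ 3 → 4 + (s + s) ≤ length ℱ
  larger (inj₁ refl) with vertices 4 ≤-refl
  ... | W , uW , e , hW = subst (_≤ length ℱ) (trans (length-complete-family β₀ size₀ W uW hW) (cong tri e))
    (maximum _ (subst (λ k → Extremal (tri (k ∸ 2)) t (complete-family β₀ size₀ W uW hW)) e
      (complete-family-extremal β₀ size₀ W uW hW (≤-reflexive (sym e)))))
  larger (inj₂ refl) with vertices 5 (n≤1+n 5)
  ... | W , uW , e , hW = subst (_≤ length ℱ) (trans (length-complete-family β₀ size₀ W uW hW) (cong tri e))
    (maximum _ (subst (λ k → Extremal (tri (k ∸ 2)) t (complete-family β₀ size₀ W uW hW)) e
      (complete-family-extremal β₀ size₀ W uW hW (subst (4 ≤_) (sym e) (n≤1+n 4)))))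

  uniq = proj₁ U

  unif : ∀ {A} → A ∈ ℱ → ∣ A ∣ ≡ t + 1
  unif = All.lookup (proj₂ U)

  Conclusion : Set
  Conclusion = (s ≡ 1 × IsoTo ℱ (Star (t + 3) (t + 1) (t ∸ 1)))
    ⊎ (s ≡ 3 × IsoTo ℱ (Star (t + 4) (t + 1) (t ∸ 1)))
    ⊎ (s ≡ 3 × 2 ≤ t × IsoTo ℱ (Star (t + 3) (t + 1) (t ∸ 2)))
    ⊎ (s ≡ 6 × IsoTo ℱ (Star (t + 5) (t + 1) (t ∸ 1)))
    ⊎ (s ≡ 6 × 3 ≤ t × IsoTo ℱ (Star (t + 3) (t + 1) (t ∸ 3)))
    ⊎ (s ≢ 1 × s ≢ 3 × IsoTo ℱ (Hilton (t + s + 2) t (t ∸ 1)))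
    ⊎ (s ≢ 1 × s ≢ 3 × t ≥ s × IsoTo ℱ (Hilton (t + 3) t (t ∸ s)))

  -- The lower end always has t - 1 elements, the upper end t - 1 plus the number of vertices, which
  -- is 4, 5, 6 or s + 3.
  from-star : ∀ β → BaseSize t false β → (∀ {N} → N ∈ ℱ → Within false β N) → ∀ {A B} → A ∈ ℱ → B ∈ ℱ → Conf t A B → Conclusion
  from-star β size within A∈ B∈ c = go (classify A∈ B∈ c)
    where
    open Graph ℱ uniq unif almost large larger 1≤s false β size within
    open Structure ℱ uniq unif almost large larger 1≤s false β size within
    lo≡ : ∣ β ∣ ≡ t ∸ 1
    lo≡ = x+k≡y⇒x≡y∸k ∣ β ∣ t 1 (+2⇒+1 ∣ β ∣ t size)
    go : Shape → Conclusion
    go (complete W all hW covered cases) = by-size cases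
      where
      hi≡ : ∀ k → length W ≡ suc k → ∣ hi β W false ∣ ≡ t + k
      hi≡ k len = star-hi ∣ hi β W false ∣ t k
        (trans (proj₂ (interval-sizes β W {t} false size (AllPairs.map E.ends≢ all) hW)) (cong (t + 1 +_) len))
      iso : ∀ k → length W ≡ suc k → IsoTo ℱ (Star (t + k) (t + 1) (t ∸ 1))
      iso k len = subst (λ x → IsoTo ℱ (Star (t + k) (t + 1) x)) lo≡ (subst (λ x → IsoTo ℱ (Star x (t + 1) ∣ β ∣))
        (hi≡ k len)
        (complete⇒Star W all hW covered))
      by-size : length W ≡ 4 × s ≡ 1 ⊎ length W ≡ 5 × s ≡ 3 ⊎ length W ≡ 6 × s ≡ 6 → Conclusion
      by-size (inj₁ (len , s≡1)) = inj₁ (s≡1 , iso 3 len)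
      by-size (inj₂ (inj₁ (len , s≡3))) = inj₂ (inj₁ (s≡3 , iso 4 len))
      by-size (inj₂ (inj₂ (len , s≡6))) = inj₂ (inj₂ (inj₂ (inj₁ (s≡6 , iso 5 len))))
    go (join a d V uW len a-d spokes covered touch s≢1 s≢3) = inj₂ (inj₂ (inj₂ (inj₂ (inj₂ (inj₁ (s≢1 , s≢3 ,
      subst (λ x → IsoTo ℱ (Hilton (t + s + 2) t x)) lo≡ (subst (λ x → IsoTo ℱ (Hilton x t ∣ β ∣)) hi≡ iso)))))))
      where
      hW = proj₁ (join⇒Hilton a d V a-d spokes covered touch)
      iso = proj₂ (join⇒Hilton a d V a-d spokes covered touch)
      hi≡ : ∣ hi β (a ∷ d ∷ V) false ∣ ≡ t + s + 2
      hi≡ = trans (star-hi ∣ hi β (a ∷ d ∷ V) false ∣ t (2 + s)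
        (trans (proj₂ (interval-sizes β (a ∷ d ∷ V) {t} false size uW hW)) (cong (λ x → t + 1 + (2 + x)) len)))
        (trans (cong (t +_) (+-comm 2 s)) (sym (+-assoc t s 2)))

  -- The upper end always has t + 3 elements, the lower end t + 3 minus the number of vertices; that
  -- this is not negative yields the lower bounds on t.
  from-top : ∀ β → BaseSize t true β → (∀ {N} → N ∈ ℱ → Within true β N) → ∀ {A B} → A ∈ ℱ → B ∈ ℱ → Conf t A B → Conclusion
  from-top β size within A∈ B∈ c = go (classify A∈ B∈ c)
    where
    open Graph ℱ uniq unif almost large larger 1≤s true β size within
    open Structure ℱ uniq unif almost large larger 1≤s true β size within
    hi≡ : ∣ β ∣ ≡ t + 3
    hi≡ = trans size (+-assoc t 1 2)
    go : Shape → Conclusion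
    go (complete W all hW covered cases) = by-size cases
      where
      lo+ : ∀ j → length W ≡ j + 3 → ∣ lo β W true ∣ + j ≡ t
      lo+ j len = top-lo ∣ lo β W true ∣ t j (trans (cong (∣ lo β W true ∣ +_) (sym len))
        (proj₁ (interval-sizes β W {t} true size (AllPairs.map E.ends≢ all) hW)))
      iso : ∀ j → length W ≡ j + 3 → IsoTo ℱ (Star (t + 3) (t + 1) (t ∸ j))
      iso j len = subst (λ x → IsoTo ℱ (Star (t + 3) (t + 1) x)) (x+k≡y⇒x≡y∸k ∣ lo β W true ∣ t j (lo+ j len))
        (subst (λ x → IsoTo ℱ (Star x (t + 1) ∣ lo β W true ∣)) hi≡ (complete⇒Star W all hW covered))
      by-size : length W ≡ 4 × s ≡ 1 ⊎ length W ≡ 5 × s ≡ 3 ⊎ length W ≡ 6 × s ≡ 6 → Conclusion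
      -- On four vertices, adding two elements and removing two are the same, so K₄ leads to the
      -- first family again.
      by-size (inj₁ (len , s≡1)) = inj₁ (s≡1 , iso 1 len)
      by-size (inj₂ (inj₁ (len , s≡3))) = inj₂ (inj₂ (inj₁ (s≡3 , m+n≤o⇒n≤o ∣ lo β W true ∣ (≤-reflexive (lo+ 2 len)) , iso 2 len)))
      by-size (inj₂ (inj₂ (len , s≡6))) =
        inj₂ (inj₂ (inj₂ (inj₂ (inj₁ (s≡6 , m+n≤o⇒n≤o ∣ lo β W true ∣ (≤-reflexive (lo+ 3 len)) , iso 3 len)))))
    go (join a d V uW len a-d spokes covered touch s≢1 s≢3) = inj₂ (inj₂ (inj₂ (inj₂ (inj₂ (inj₂ (s≢1 , s≢3 ,
      m+n≤o⇒n≤o ∣ lo β (a ∷ d ∷ V) true ∣ (≤-reflexive lo+) ,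
      subst (λ x → IsoTo ℱ (Hilton (t + 3) t x)) (x+k≡y⇒x≡y∸k ∣ lo β (a ∷ d ∷ V) true ∣ t s lo+)
        (subst (λ x → IsoTo ℱ (Hilton x t ∣ lo β (a ∷ d ∷ V) true ∣)) hi≡ iso)))))))
      where
      hW = proj₁ (join⇒Hilton a d V a-d spokes covered touch)
      iso = proj₂ (join⇒Hilton a d V a-d spokes covered touch)
      lo+ : ∣ lo β (a ∷ d ∷ V) true ∣ + s ≡ t
      lo+ = top-lo ∣ lo β (a ∷ d ∷ V) true ∣ t s
        (trans (cong (∣ lo β (a ∷ d ∷ V) true ∣ +_) (trans (+-comm s 3) (cong (2 +_) (sym len))))
        (proj₁ (interval-sizes β (a ∷ d ∷ V) {t} true size uW hW)))

  conflict : ∃₂ λ A B → A ∈ ℱ × B ∈ ℱ × Conf t A B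
  conflict with Any.any? (λ A → Any.any? (conf? t A) ℱ) ℱ
  ... | no none = contradiction (λ A B A∈ B∈ → ≮⇒≥ λ c → none (lose A∈ (lose B∈ c))) ¬int
  ... | yes some with find some
  ...   | A , A∈ , some′ with find some′
  ...     | B , B∈ , c = A , B , A∈ , B∈ , c

  open AlmostIntersectingFamily ℱ uniq unif almost large

  conclusion : Conclusion
  conclusion with conflict
  ... | A , B , A∈ , B∈ , c with conf⇒two A B (unif A∈) c
  ...   | p , q , p≢q , (ap , bp) , (aq , bq) with quad A∈ B∈ p≢q ap aq bp bq
  ...     | Q , _ with star-or-top A∈ B∈ Q
  ...       | inj₁ ⊇∩ = from-star (A ∩ B) (trans (cong (∣ A ∩ B ∣ +_) (sym (∣A∖B∣ Q))) (trans (∣∩∣+∣∖∣ A B) (unif A∈)))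
    (λ N∈ i e → ⊇∩ N∈ i e) A∈ B∈ c
  ...       | inj₂ ⊆∪ = from-top (A ∪ B) (trans (∣A∪B∣ Q) (cong (_+ 2) (unif A∈))) (λ N∈ i e → ⊆∪ N∈ i e) A∈ B∈ c

theorem1p5 : (n t s : ℕ) → 1 ≤ t → 1 ≤ s → t + s + 2 ≤ n →
    (ℱ : Family n) → IsUniform (t + 1) ℱ → AlmostIntersecting s t ℱ → ¬ Intersecting t ℱ →
    ((𝒢 : Family n) → IsUniform (t + 1) 𝒢 → AlmostIntersecting s t 𝒢 → ¬ Intersecting t 𝒢 →
    length 𝒢 ≤ length ℱ) →
    (s ≡ 1 × IsoTo ℱ (Star (t + 3) (t + 1) (t ∸ 1)))
    ⊎ (s ≡ 3 × IsoTo ℱ (Star (t + 4) (t + 1) (t ∸ 1)))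
    ⊎ (s ≡ 3 × 2 ≤ t × IsoTo ℱ (Star (t + 3) (t + 1) (t ∸ 2)))
    ⊎ (s ≡ 6 × IsoTo ℱ (Star (t + 5) (t + 1) (t ∸ 1)))
    ⊎ (s ≡ 6 × 3 ≤ t × IsoTo ℱ (Star (t + 3) (t + 1) (t ∸ 3)))
    ⊎ (s ≢ 1 × s ≢ 3 × IsoTo ℱ (Hilton (t + s + 2) t (t ∸ 1)))
    ⊎ (s ≢ 1 × s ≢ 3 × t ≥ s × IsoTo ℱ (Hilton (t + 3) t (t ∸ s)))
theorem1p5 n t s 1≤t 1≤s n-large ℱ uniform almost ¬int maximum =
  Final.conclusion 1≤t 1≤s n-large ℱ uniform almost ¬int λ 𝒢 (u , a , ¬i) → maximum 𝒢 u a ¬i
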